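{- Let $(f_n)$ be a family of polynomials in $\mathsf{VP}^0$, with $d_n=\deg(f_n)$. Then $(f_n)$ can be computed by a family $(\Gamma_n)$ of depth four circuits with $n^{O(\log d_n)}$ addition gates and $n^{O(\sqrt{d_n}\log d_n)}$ multiplication gates. The family $(f_n)$ can also be computed by a family $(F_n)$ of depth four arithmetic formulas of size $n^{O(\sqrt{d_n}\log d_n)}$. The inputs of $\Gamma_n$ and $F_n$ are variables of $f_n$ or integers of bit size polynomial in $n$, and their multiplication gates have fan-in at most $\sqrt{3d_n}+1$.
   Context: A constant-free arithmetic circuit has input gates labelled by variables or constants from $\{ -1,0,1\}$, and addition and multiplication gates; its size is its number of gates. Formal degree: 1 for inputs, maximum of inputs' formal degrees for addition gates, sum for multiplication gates; the circuit's formal degree is that of its output. A family $(f_n)$ of integer polynomials belongs to $\mathsf{VP}^0$ if there is a polynomial $p$ and constant-free circuits $C_n$ with unweighted addition gates and multiplication gates such that $C_n$ computes $f_n$ and has size and formal degree at most $p(n)$. A depth four circuit is a $\Sigma\Pi\Sigma\Pi$ circuit with gates of unbounded fan-in (output addition gate, then multiplication gates, then addition gates, then multiplication gates fed by input gates). A depth four formula is a depth four circuit where every non-output gate has fan-out one. -}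

module Defs where

open import Data.Nat using (ℕ; zero; suc; _+_; _*_; _∸_; _^_; _≤_; _<_; _≤?_)
open import Data.Nat.Logarithm using (⌊log₂_⌋)
open import Data.Integer as ℤ using (ℤ; 0ℤ; 1ℤ; -1ℤ; ∣_∣)
open import Data.Fin using (Fin; zero; suc)
open import Data.Vec as Vec using (Vec; []; _∷_; replicate; _[_]≔_)
open import Data.Vec.Properties using (≡-dec)
open import Data.List as List using (List; []; _∷_; length; concatMap; map; allFin; upTo; foldr)
open import Data.List.Relation.Unary.All using (All)
open import Data.List.Relation.Unary.Unique.Propositional using (Unique)
open import Data.List.Relation.Binary.Permutation.Propositional using (_↭_)
open import Data.Product using (_×_; _,_; Σ; ∃)
open import Data.Sum using (_⊎_)
open import Relation.Binary.PropositionalEquality using (_≡_; _≢_)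
open import Relation.Nullary using (yes; no)
import Data.Nat.Properties as ℕP

-- Multivariate integer polynomials in k variables x_0..x_{k-1},
-- represented by their coefficient function on exponent vectors.

Mon : ℕ → Set
Mon k = Vec ℕ k

∣_∣ₘ : ∀ {k} → Mon k → ℕ
∣ m ∣ₘ = Vec.sum m

Poly : ℕ → Set
Poly k = Mon k → ℤ

_≈P_ : ∀ {k} → Poly k → Poly k → Set
f ≈P g = ∀ m → f m ≡ g m

infix 4 _≈P_

constP : ∀ {k} → ℤ → Poly k
constP {k} z m with ≡-dec ℕP._≟_ m (replicate k 0)
... | yes _ = z
... | no  _ = 0ℤ

varP : ∀ {k} → Fin k → Poly k
varP {k} i m with ≡-dec ℕP._≟_ m (replicate k 0 [ i ]≔ 1)
... | yes _ = 1ℤ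
... | no  _ = 0ℤ

_+P_ : ∀ {k} → Poly k → Poly k → Poly k
(f +P g) m = f m ℤ.+ g m

splits : ∀ {k} → Mon k → List (Mon k × Mon k)
splits [] = ([] , []) ∷ []
splits (e ∷ m) =
  concatMap (λ i → map (λ { (a , b) → (i ∷ a , (e ∸ i) ∷ b) }) (splits m))
            (upTo (suc e))

_*P_ : ∀ {k} → Poly k → Poly k → Poly k
(f *P g) m = List.foldr ℤ._+_ 0ℤ (map (λ { (a , b) → f a ℤ.* g b }) (splits m))

sumP : ∀ {k} → List (Poly k) → Poly k
sumP = foldr _+P_ (constP 0ℤ)

prodP : ∀ {k} → List (Poly k) → Poly k
prodP = foldr _*P_ (constP 1ℤ)

-- Degree (total degree); the zero polynomial is given degree 0 by convention.
IsDegree : ∀ {k} → Poly k → ℕ → Set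
IsDegree f d =
  (∀ m → d < ∣ m ∣ₘ → f m ≡ 0ℤ) ×
  (d ≡ 0 ⊎ Σ (Mon _) (λ m → ∣ m ∣ₘ ≡ d × f m ≢ 0ℤ))

-- Constant-free arithmetic circuits (fan-in two), as a list of gates in
-- topological order; the head of the list is the output gate.
-- A gate of a circuit with s earlier gates refers to those by Fin s
-- (index zero = the most recently added gate).

data Const : Set where
  c-1 c0 c1 : Const

constVal : Const → ℤ
constVal c-1 = -1ℤ
constVal c0  = 0ℤ
constVal c1  = 1ℤ

data Gate (k s : ℕ) : Set where
  input-var : Fin k → Gate k s
  input-cst : Const → Gate k s
  add       : Fin s → Fin s → Gate k s
  mul       : Fin s → Fin s → Gate k s

data Circuit (k : ℕ) : ℕ → Set where
  []  : Circuit k 0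
  _∷_ : ∀ {s} → Gate k s → Circuit k s → Circuit k (suc s)

values : ∀ {k s} → Circuit k s → Vec (Poly k) s
values [] = []
values (g ∷ C) = gateVal g ∷ vs
  where
  vs = values C
  gateVal : _ → _
  gateVal (input-var i) = varP i
  gateVal (input-cst c) = constP (constVal c)
  gateVal (add i j) = Vec.lookup vs i +P Vec.lookup vs j
  gateVal (mul i j) = Vec.lookup vs i *P Vec.lookup vs j

fdegs : ∀ {k s} → Circuit k s → Vec ℕ s
fdegs [] = []
fdegs (g ∷ C) = gateDeg g ∷ ds
  where
  ds = fdegs C
  gateDeg : _ → ℕ
  gateDeg (input-var i) = 1
  gateDeg (input-cst c) = 1
  gateDeg (add i j) = Vec.lookup ds i Data.Nat.⊔ Vec.lookup ds j
  gateDeg (mul i j) = Vec.lookup ds i + Vec.lookup ds j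

output : ∀ {k s} → Circuit k (suc s) → Poly k
output C = Vec.head (values C)

formalDegree : ∀ {k s} → Circuit k (suc s) → ℕ
formalDegree C = Vec.head (fdegs C)

-- "at most p(n) for some polynomial p": bounded by c * n ^ c + c
polyBound : ℕ → ℕ → ℕ
polyBound c n = c * n ^ c + c

VP⁰ : (v : ℕ → ℕ) → ((n : ℕ) → Poly (v n)) → Set
VP⁰ v f = Σ ℕ λ c → ∀ n → Σ ℕ λ s → Σ (Circuit (v n) (suc s)) λ C →
  suc s ≤ polyBound c n × formalDegree C ≤ polyBound c n × output C ≈P f n

-- Depth four (ΣΠΣΠ) circuits with unbounded fan-in.
-- Layers, bottom-up: input gates, bottom multiplication gates (mul₁),
-- addition gates (add₂), top multiplication gates (mul₃), output
-- addition gate. Each gate lists its children (with multiplicity).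

data Leaf (k : ℕ) : Set where
  var : Fin k → Leaf k
  num : ℤ → Leaf k

record Depth4 (k : ℕ) : Set where
  field
    nIn nMul₁ nAdd₂ nMul₃ : ℕ
    inp  : Fin nIn → Leaf k
    mul₁ : Fin nMul₁ → List (Fin nIn)
    add₂ : Fin nAdd₂ → List (Fin nMul₁)
    mul₃ : Fin nMul₃ → List (Fin nAdd₂)
    out  : List (Fin nMul₃)

  leafVal : Fin nIn → Poly k
  leafVal i with inp i
  ... | var x = varP x
  ... | num z = constP z

  mul₁Val : Fin nMul₁ → Poly k
  mul₁Val j = prodP (map leafVal (mul₁ j))

  add₂Val : Fin nAdd₂ → Poly k
  add₂Val j = sumP (map mul₁Val (add₂ j))

  mul₃Val : Fin nMul₃ → Poly k
  mul₃Val j = prodP (map add₂Val (mul₃ j))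

  outVal : Poly k
  outVal = sumP (map mul₃Val out)

  #add : ℕ
  #add = suc nAdd₂

  #mul : ℕ
  #mul = nMul₁ + nMul₃

  size : ℕ
  size = nIn + nMul₁ + nAdd₂ + nMul₃ + 1

  SimpleAdd : Set
  SimpleAdd = (∀ j → Unique (add₂ j)) × Unique out

  ConstBits≤ : ℕ → Set
  ConstBits≤ b = ∀ i z → inp i ≡ num z → ∣ z ∣ < 2 ^ b

  -- formula: every non-output gate has fan-out exactly one
  IsFormula : Set
  IsFormula =
    concatMap mul₁ (allFin nMul₁) ↭ allFin nIn ×
    concatMap add₂ (allFin nAdd₂) ↭ allFin nMul₁ ×
    concatMap mul₃ (allFin nMul₃) ↭ allFin nAdd₂ ×
    out ↭ allFin nMul₃

-- Fan-in bound "at most √(3d) + 1" for naturals L: (L - 1)² ≤ 3d.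
FanInOK : ℕ → ℕ → Set
FanInOK d L = (L ∸ 1) * (L ∸ 1) ≤ 3 * d

MulFanInOK : ∀ {k} → ℕ → Depth4 k → Set
MulFanInOK d Γ =
  (∀ j → FanInOK d (length (mul₁ j))) × (∀ j → FanInOK d (length (mul₃ j)))
  where open Depth4 Γ

⌊√_⌋ : ℕ → ℕ
⌊√ d ⌋ = go d d
  where
  go : ℕ → ℕ → ℕ
  go d zero = zero
  go d (suc r) with suc r * suc r ≤? d
  ... | yes _ = suc r
  ... | no  _ = go d r

-- "log d" in O(log d): 1 + ⌊log₂ d⌋ (≥ 1, and Θ(log d) for d ≥ 2)
lg : ℕ → ℕ
lg d = suc ⌊log₂ d ⌋

-- "√d" in O(√d log d): 1 + ⌊√d⌋ (≥ 1, and Θ(√d) for d ≥ 1)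
sq : ℕ → ℕ
sq d = suc ⌊√ d ⌋

{-# OPTIONS --safe #-}

-- Write every homogeneous component of the output as a sum over the runs of a stack machine.
-- A stack is a list of pairs (gate, degree) and stands for the product of the corresponding
-- homogeneous components. The top pair is expanded until a variable is emitted; at a
-- multiplication gate the factor of smaller degree is expanded first and the other one waits on
-- the stack. Each degree on the stack then dominates the sum of those above it, so a stack of
-- total degree at most d has at most 1 + log d entries, and there are only n^O(log d) stacks.
--
-- With r = ⌊√3d⌋, cut the runs into r + 1 blocks emitting at most r variables each, which suffices
-- as d ≤ r (r + 1). The runs of one block leading from a stack S to a stack S′ sum up to a
-- polynomial of degree at most r, computed by one addition gate fed by (coefficient × word) gates.
-- A top multiplication gate is a sequence of stacks through which a run passes at the block ends.
-- The coefficients are small since the total weight of all runs from a gate of formal degree δ is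
-- at most exponential in (circuit size) · δ · (d + 1).
module Submission where

open import Defs
open import Algebra.Bundles using (CommutativeSemiring)
open import Algebra.Structures using (IsCommutativeSemiring)
open import Algebra.Structures.Biased using (isCommutativeSemiringˡ; isCommutativeMonoidˡ)
open import Data.Empty using (⊥-elim)
open import Data.Fin as Fin using (Fin; zero; suc; toℕ; combine; remQuot; _↑ˡ_; _↑ʳ_)
import Data.Fin.Properties as FinP
open import Data.Integer using (ℤ; 0ℤ; 1ℤ; ∣_∣) renaming (_+_ to _+ᶻ_; _*_ to _*ᶻ_)
import Data.Integer.Properties as ℤP
open import Data.List as List using (List; []; _∷_; _++_; map; foldr; concat; concatMap; length; filter; tabulate; allFin; upTo; applyUpTo; cartesianProduct; cartesianProductWith)
import Data.List.Properties as ListP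
open import Data.List.Membership.Propositional using (_∈_)
import Data.List.Membership.Propositional.Properties as ∈P
open import Data.List.Relation.Binary.Permutation.Propositional using (_↭_; ↭-refl; ↭-reflexive)
open import Data.List.Relation.Unary.All as All using (All; []; _∷_)
import Data.List.Relation.Unary.All.Properties as AllP
open import Data.List.Relation.Unary.AllPairs using ([]; _∷_)
open import Data.List.Relation.Unary.Any using (here; there; index)
open import Data.List.Relation.Unary.Any.Properties using (lookup-index)
open import Data.List.Relation.Unary.Unique.Propositional using (Unique)
import Data.List.Relation.Unary.Unique.Propositional.Properties as Uniq
open import Data.Maybe using (Maybe; just; nothing)
import Data.Maybe.Properties as MaybeP
open import Data.Nat using (ℕ; zero; suc; _+_; _*_; _∸_; _^_; _≤_; _<_; _⊔_; z≤n; s≤s; s≤s⁻¹; _≤?_; NonZero; >-nonZero)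
open import Data.Nat.ListAction using (sum)
open import Data.Nat.ListAction.Properties using (sum-++)
open import Data.Nat.Logarithm using (⌊log₂⌋-mono-≤; ⌊log₂[2^n]⌋≡n)
import Data.Nat.Properties as ℕP
open import Data.Nat.Tactic.RingSolver using (solve-∀)
open import Data.Product using (Σ; _×_; _,_; proj₁; proj₂; uncurry)
import Data.Product.Properties as ×P
open import Data.Sum using (_⊎_; inj₁; inj₂)
open import Data.Unit using (⊤; tt)
open import Data.Vec as Vec using (Vec; []; _∷_; replicate; _[_]≔_; lookup)
open import Data.Vec.Properties using (≡-dec)
open import Data.Vec.Relation.Unary.All as VAll using ([]; _∷_)
open import Function using (_∘_; id)
open import Level using (0ℓ)
open import Relation.Binary.Definitions using (DecidableEquality)
open import Relation.Binary.PropositionalEquality as ≡ using (_≡_; _≢_; refl; sym; trans; cong; cong₂; subst)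
open import Relation.Binary.Structures using (IsEquivalence)
open import Relation.Nullary using (Dec; yes; no)
open import Relation.Nullary.Decidable using (_×-dec_)

-- Finite sums and the semiring of polynomials

-- The runs cannot be listed one by one: repeated doubling of a single variable already has
-- exponentially many runs, all of length one. Runs of a block that emit the same word and reach the
-- same stack are therefore merged into one integer coefficient. Then only words and stacks are
-- counted, and the multiplicity of the runs moves into the bit size of the constants. Factors of
-- degree 0 never enter the stack; they are replaced by their constant terms. So every stack entry
-- has positive degree, and every expansion emits exactly one variable and lowers the total degree
-- by one. This makes block lengths predictable and turns domination into a logarithmic bound on the
-- number of entries. Both multiplication layers get fan-in r + 1: below, one slot for the
-- coefficient and r for the letters; above, one slot for each of the r + 1 blocks.

module Sums {c ℓ} (R : CommutativeSemiring c ℓ) where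
  open CommutativeSemiring R renaming (_+_ to _⊕_; _*_ to _⊗_; refl to ≈-refl; sym to ≈-sym; trans to ≈-trans)
  open import Relation.Binary.Reasoning.Setoid setoid
  open import Algebra.Properties.CommutativeSemigroup +-commutativeSemigroup using (interchange)

  ∑ : {A : Set} → List A → (A → Carrier) → Carrier
  ∑ xs f = foldr _⊕_ 0# (map f xs)

  ∑₂ : {A B : Set} → List (A × B) → (A → B → Carrier) → Carrier
  ∑₂ xs f = ∑ xs (λ p → f (proj₁ p) (proj₂ p))

  module _ {A : Set} where

    ∑-congᴬ : {f g : A → Carrier} {xs : List A} → All (λ x → f x ≈ g x) xs → ∑ xs f ≈ ∑ xs g
    ∑-congᴬ [] = ≈-refl
    ∑-congᴬ (e ∷ es) = +-cong e (∑-congᴬ es)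

    ∑-cong : (xs : List A) {f g : A → Carrier} → (∀ x → f x ≈ g x) → ∑ xs f ≈ ∑ xs g
    ∑-cong xs e = ∑-congᴬ (All.universal e xs)

    ∑-++ : (xs ys : List A) (f : A → Carrier) → ∑ (xs ++ ys) f ≈ ∑ xs f ⊕ ∑ ys f
    ∑-++ [] ys f = ≈-sym (+-identityˡ _)
    ∑-++ (x ∷ xs) ys f = ≈-trans (+-congˡ (∑-++ xs ys f)) (≈-sym (+-assoc _ _ _))

    ∑-zero : (xs : List A) {f : A → Carrier} → (∀ x → f x ≈ 0#) → ∑ xs f ≈ 0#
    ∑-zero [] e = ≈-refl
    ∑-zero (x ∷ xs) e = ≈-trans (+-cong (e x) (∑-zero xs e)) (+-identityˡ _)

    ∑-⊕ : (xs : List A) (f g : A → Carrier) → ∑ xs (λ x → f x ⊕ g x) ≈ ∑ xs f ⊕ ∑ xs g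
    ∑-⊕ [] f g = ≈-sym (+-identityˡ _)
    ∑-⊕ (x ∷ xs) f g = ≈-trans (+-congˡ (∑-⊕ xs f g)) (interchange _ _ _ _)

    ∑-⊗ˡ : (a : Carrier) (xs : List A) (f : A → Carrier) → a ⊗ ∑ xs f ≈ ∑ xs (λ x → a ⊗ f x)
    ∑-⊗ˡ a [] f = zeroʳ a
    ∑-⊗ˡ a (x ∷ xs) f = ≈-trans (distribˡ _ _ _) (+-congˡ (∑-⊗ˡ a xs f))

    ∑-⊗ʳ : (a : Carrier) (xs : List A) (f : A → Carrier) → ∑ xs f ⊗ a ≈ ∑ xs (λ x → f x ⊗ a)
    ∑-⊗ʳ a [] f = zeroˡ a
    ∑-⊗ʳ a (x ∷ xs) f = ≈-trans (distribʳ _ _ _) (+-congˡ (∑-⊗ʳ a xs f))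

  ∑-map : {A B : Set} (h : A → B) (xs : List A) (f : B → Carrier) → ∑ (map h xs) f ≈ ∑ xs (λ x → f (h x))
  ∑-map h [] f = ≈-refl
  ∑-map h (x ∷ xs) f = +-congˡ (∑-map h xs f)

  ∑-concatMap : {A B : Set} (h : A → List B) (xs : List A) (f : B → Carrier) →
                ∑ (concatMap h xs) f ≈ ∑ xs (λ x → ∑ (h x) f)
  ∑-concatMap h [] f = ≈-refl
  ∑-concatMap h (x ∷ xs) f = ≈-trans (∑-++ (h x) (concatMap h xs) f) (+-congˡ (∑-concatMap h xs f))

  ∑-swap : {A B : Set} (xs : List A) (ys : List B) (f : A → B → Carrier) →
           ∑ xs (λ x → ∑ ys (f x)) ≈ ∑ ys (λ y → ∑ xs (λ x → f x y))
  ∑-swap [] ys f = ≈-sym (∑-zero ys (λ _ → ≈-refl))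
  ∑-swap (x ∷ xs) ys f = ≈-trans (+-congˡ (∑-swap xs ys f)) (≈-sym (∑-⊕ ys _ _))

  ∑-upTo-suc : ∀ n (f : ℕ → Carrier) → ∑ (upTo (suc n)) f ≈ f 0 ⊕ ∑ (upTo n) (λ e → f (suc e))
  ∑-upTo-suc n f = +-congˡ (≈-trans
    (reflexive (cong (λ l → ∑ l f) (sym (ListP.map-upTo suc n)))) (∑-map suc (upTo n) f))

  ∑-delta : {A : Set} {xs : List A} {x : A} {f : A → Carrier} → Unique xs → x ∈ xs →
            (∀ y → y ≢ x → f y ≈ 0#) → ∑ xs f ≈ f x
  ∑-delta {xs = y ∷ xs} (y∉ ∷ u) (here refl) z =
    ≈-trans (+-congˡ (≈-trans (∑-congᴬ (All.map (λ ne → z _ (λ e → ne (sym e))) y∉)) (∑-zero xs (λ _ → ≈-refl)))) (+-identityʳ _)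
  ∑-delta {xs = y ∷ xs} (y∉ ∷ u) (there x∈) z =
    ≈-trans (+-cong (z y (All.lookup y∉ x∈)) (∑-delta u x∈ z)) (+-identityˡ _)

  ∑-cartesianProduct : {A B : Set} (xs : List A) (ys : List B) (f : A → B → Carrier) →
    ∑₂ (cartesianProduct xs ys) f ≈ ∑ xs (λ x → ∑ ys (f x))
  ∑-cartesianProduct [] ys f = ≈-refl
  ∑-cartesianProduct (x ∷ xs) ys f = ≈-trans (∑-++ (map (x ,_) ys) _ _)
    (+-cong (∑-map (x ,_) ys _) (∑-cartesianProduct xs ys f))

ℤ-semiring : CommutativeSemiring 0ℓ 0ℓ
ℤ-semiring = ℤP.+-*-commutativeSemiring

open module ℤΣ = Sums ℤ-semiring using (∑; ∑₂)

-- Antidiagonal sums and the convolution product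

anti : ℕ → List (ℕ × ℕ)
anti zero = (0 , 0) ∷ []
anti (suc e) = (0 , suc e) ∷ map (λ p → suc (proj₁ p) , proj₂ p) (anti e)

anti-sum : ∀ e → All (λ p → proj₁ p + proj₂ p ≡ e) (anti e)
anti-sum zero = refl ∷ []
anti-sum (suc e) = refl ∷ AllP.map⁺ (All.map (cong suc) (anti-sum e))

length-anti : ∀ e → List.length (anti e) ≡ suc e
length-anti zero = refl
length-anti (suc e) = cong suc (trans (ListP.length-map _ (anti e)) (length-anti e))

∑-anti-suc : ∀ e (G : ℕ → ℕ → ℤ) →
  ∑₂ (anti (suc e)) G ≡ G 0 (suc e) +ᶻ ∑₂ (anti e) (λ i j → G (suc i) j)
∑-anti-suc e G = cong (G 0 (suc e) +ᶻ_) (ℤΣ.∑-map _ (anti e) _)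

∑-anti-last : ∀ e (G : ℕ → ℕ → ℤ) →
  ∑₂ (anti (suc e)) G ≡ G (suc e) 0 +ᶻ ∑₂ (anti e) (λ i j → G i (suc j))
∑-anti-last zero G = trans (cong (G 0 1 +ᶻ_) (ℤP.+-identityʳ (G 1 0)))
  (trans (ℤP.+-comm (G 0 1) (G 1 0)) (cong (G 1 0 +ᶻ_) (sym (ℤP.+-identityʳ (G 0 1)))))
∑-anti-last (suc e) G = begin
  ∑₂ (anti (suc (suc e))) G
    ≡⟨ ∑-anti-suc (suc e) G ⟩
  G 0 (suc (suc e)) +ᶻ ∑₂ (anti (suc e)) (λ i j → G (suc i) j)
    ≡⟨ cong (G 0 (suc (suc e)) +ᶻ_) (∑-anti-last e (λ i j → G (suc i) j)) ⟩
  G 0 (suc (suc e)) +ᶻ (G (suc (suc e)) 0 +ᶻ rest)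
    ≡⟨ x∙yz≈y∙xz (G 0 (suc (suc e))) (G (suc (suc e)) 0) rest ⟩
  G (suc (suc e)) 0 +ᶻ (G 0 (suc (suc e)) +ᶻ rest)
    ≡⟨ cong (G (suc (suc e)) 0 +ᶻ_) (∑-anti-suc e (λ i j → G i (suc j))) ⟨
  G (suc (suc e)) 0 +ᶻ ∑₂ (anti (suc e)) (λ i j → G i (suc j)) ∎
  where
  open ≡.≡-Reasoning
  open import Algebra.Properties.CommutativeSemigroup ℤP.+-commutativeSemigroup using (x∙yz≈y∙xz)
  rest = ∑₂ (anti e) (λ i j → G (suc i) (suc j))

∑-anti-comm : ∀ e (G : ℕ → ℕ → ℤ) → ∑₂ (anti e) G ≡ ∑₂ (anti e) (λ i j → G j i)
∑-anti-comm zero G = refl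
∑-anti-comm (suc e) G = trans (∑-anti-suc e G)
  (trans (cong (G 0 (suc e) +ᶻ_) (∑-anti-comm e _)) (sym (∑-anti-last e (λ i j → G j i))))

-- Both sides run over the triples with sum e. The triples with first index 0 form
-- `∑₂ (anti (suc e)) (G 0)` on either side; the others are left to the induction.
∑-anti-assoc : ∀ e (G : ℕ → ℕ → ℕ → ℤ) →
  ∑₂ (anti e) (λ i l → ∑₂ (anti i) (λ j k → G j k l)) ≡
  ∑₂ (anti e) (λ j n → ∑₂ (anti n) (λ k l → G j k l))
∑-anti-assoc zero G = refl
∑-anti-assoc (suc e) G = begin
  ∑₂ (anti (suc e)) (λ i l → ∑₂ (anti i) (λ j k → G j k l))
    ≡⟨ ∑-anti-suc e (λ i l → ∑₂ (anti i) (λ j k → G j k l)) ⟩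
  (G 0 0 (suc e) +ᶻ 0ℤ) +ᶻ ∑₂ (anti e) (λ i l → ∑₂ (anti (suc i)) (λ j k → G j k l))
    ≡⟨ cong₂ _+ᶻ_ (ℤP.+-identityʳ (G 0 0 (suc e)))
         (ℤΣ.∑-cong (anti e) (λ p → ∑-anti-suc (proj₁ p) (λ j k → G j k (proj₂ p)))) ⟩
  G 0 0 (suc e) +ᶻ ∑₂ (anti e) (λ i l → G 0 (suc i) l +ᶻ ∑₂ (anti i) (λ j k → G (suc j) k l))
    ≡⟨ cong (G 0 0 (suc e) +ᶻ_) (ℤΣ.∑-⊕ (anti e) _ _) ⟩
  G 0 0 (suc e) +ᶻ (∑₂ (anti e) (λ i l → G 0 (suc i) l)
    +ᶻ ∑₂ (anti e) (λ i l → ∑₂ (anti i) (λ j k → G (suc j) k l)))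
    ≡⟨ ℤP.+-assoc (G 0 0 (suc e)) _ _ ⟨
  (G 0 0 (suc e) +ᶻ ∑₂ (anti e) (λ i l → G 0 (suc i) l))
    +ᶻ ∑₂ (anti e) (λ i l → ∑₂ (anti i) (λ j k → G (suc j) k l))
    ≡⟨ cong₂ _+ᶻ_ (sym (∑-anti-suc e (G 0))) (∑-anti-assoc e (λ j → G (suc j))) ⟩
  ∑₂ (anti (suc e)) (G 0) +ᶻ ∑₂ (anti e) (λ j n → ∑₂ (anti n) (G (suc j)))
    ≡⟨ ∑-anti-suc e (λ j n → ∑₂ (anti n) (λ k l → G j k l)) ⟨
  ∑₂ (anti (suc e)) (λ j n → ∑₂ (anti n) (λ k l → G j k l)) ∎
  where open ≡.≡-Reasoning

∑-anti-head : ∀ e (G : ℕ → ℕ → ℤ) → (∀ i j → G (suc i) j ≡ 0ℤ) → ∑₂ (anti e) G ≡ G 0 e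
∑-anti-head zero G z = ℤP.+-identityʳ _
∑-anti-head (suc e) G z = trans (∑-anti-suc e G)
  (trans (cong (G 0 (suc e) +ᶻ_) (ℤΣ.∑-zero (anti e) (λ p → z (proj₁ p) (proj₂ p)))) (ℤP.+-identityʳ _))

-- `splits` runs over one index and recovers the other by truncated subtraction. In the pairs of
-- `anti` both indices vary structurally, which the proofs of symmetry and associativity rely on.
∑-upTo-anti : ∀ e (G : ℕ → ℕ → ℤ) → ∑ (upTo (suc e)) (λ i → G i (e ∸ i)) ≡ ∑₂ (anti e) G
∑-upTo-anti zero G = refl
∑-upTo-anti (suc e) G = trans (cong (G 0 (suc e) +ᶻ_) shift) (sym (∑-anti-suc e G))
  where
  shift : ∑ (applyUpTo suc (suc e)) (λ i → G i (suc e ∸ i)) ≡ ∑₂ (anti e) (λ i j → G (suc i) j)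
  shift = trans (cong (λ l → ∑ l (λ i → G i (suc e ∸ i))) (sym (ListP.map-upTo suc (suc e))))
    (trans (ℤΣ.∑-map suc (upTo (suc e)) (λ i → G i (suc e ∸ i))) (∑-upTo-anti e (λ i j → G (suc i) j)))

∑-splits-∷ : ∀ {k} e (m : Mon k) (F : Mon (suc k) → Mon (suc k) → ℤ) →
  ∑₂ (splits (e ∷ m)) F ≡ ∑₂ (anti e) (λ i j → ∑₂ (splits m) (λ a b → F (i ∷ a) (j ∷ b)))
∑-splits-∷ e m F = begin
  ∑₂ (splits (e ∷ m)) F
    ≡⟨ cong (λ l → ∑₂ l F) (ListP.concatMap-cong (λ i → ListP.map-cong (λ _ → refl) (splits m)) (upTo (suc e))) ⟩
  ∑₂ (concatMap (λ i → map (pair i) (splits m)) (upTo (suc e))) F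
    ≡⟨ ℤΣ.∑-concatMap (λ i → map (pair i) (splits m)) (upTo (suc e)) (uncurry F) ⟩
  ∑ (upTo (suc e)) (λ i → ∑₂ (map (pair i) (splits m)) F)
    ≡⟨ ℤΣ.∑-cong (upTo (suc e)) (λ i → ℤΣ.∑-map (pair i) (splits m) (uncurry F)) ⟩
  ∑ (upTo (suc e)) (λ i → ∑₂ (splits m) (λ a b → F (i ∷ a) ((e ∸ i) ∷ b)))
    ≡⟨ ∑-upTo-anti e (λ i j → ∑₂ (splits m) (λ a b → F (i ∷ a) (j ∷ b))) ⟩
  ∑₂ (anti e) (λ i j → ∑₂ (splits m) (λ a b → F (i ∷ a) (j ∷ b))) ∎
  where
  open ≡.≡-Reasoning
  pair : ℕ → Mon _ × Mon _ → Mon _ × Mon _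
  pair i p = i ∷ proj₁ p , (e ∸ i) ∷ proj₂ p

-- More than a congruence: the premise may use that the two total degrees add up. `H-*` and
-- `*P-vanishes` depend on this.
∑-splits-cong : ∀ {k} (m : Mon k) {F G : Mon k → Mon k → ℤ} →
  (∀ a b → ∣ a ∣ₘ + ∣ b ∣ₘ ≡ ∣ m ∣ₘ → F a b ≡ G a b) → ∑₂ (splits m) F ≡ ∑₂ (splits m) G
∑-splits-cong [] h = cong (_+ᶻ 0ℤ) (h [] [] refl)
∑-splits-cong (e ∷ m) {F} {G} h = trans (∑-splits-∷ e m F) (trans
  (ℤΣ.∑-congᴬ (All.map step (anti-sum e)))
  (sym (∑-splits-∷ e m G)))
  where
  open import Algebra.Properties.CommutativeSemigroup ℕP.+-commutativeSemigroup using (interchange)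
  step : ∀ {p} → proj₁ p + proj₂ p ≡ e →
    ∑₂ (splits m) (λ a b → F (proj₁ p ∷ a) (proj₂ p ∷ b)) ≡ ∑₂ (splits m) (λ a b → G (proj₁ p ∷ a) (proj₂ p ∷ b))
  step {i , j} eq = ∑-splits-cong m (λ a b eq′ →
    h (i ∷ a) (j ∷ b) (trans (interchange i ∣ a ∣ₘ j ∣ b ∣ₘ) (cong₂ _+_ eq eq′)))

∑-splits-comm : ∀ {k} (m : Mon k) (F : Mon k → Mon k → ℤ) →
  ∑₂ (splits m) F ≡ ∑₂ (splits m) (λ a b → F b a)
∑-splits-comm [] F = refl
∑-splits-comm (e ∷ m) F = begin
  ∑₂ (splits (e ∷ m)) F
    ≡⟨ ∑-splits-∷ e m F ⟩
  ∑₂ (anti e) (λ i j → ∑₂ (splits m) (λ a b → F (i ∷ a) (j ∷ b)))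
    ≡⟨ ∑-anti-comm e _ ⟩
  ∑₂ (anti e) (λ i j → ∑₂ (splits m) (λ a b → F (j ∷ a) (i ∷ b)))
    ≡⟨ ℤΣ.∑-cong (anti e) (λ p → ∑-splits-comm m _) ⟩
  ∑₂ (anti e) (λ i j → ∑₂ (splits m) (λ a b → F (j ∷ b) (i ∷ a)))
    ≡⟨ ∑-splits-∷ e m (λ a b → F b a) ⟨
  ∑₂ (splits (e ∷ m)) (λ a b → F b a) ∎
  where open ≡.≡-Reasoning

-- One coordinate at a time: `∑-swap` brings the sums over the first exponent to the front,
-- `∑-anti-assoc` rebrackets them, and the other coordinates follow by induction.
∑-splits-assoc : ∀ {k} (m : Mon k) (F : Mon k → Mon k → Mon k → ℤ) →
  ∑₂ (splits m) (λ a c → ∑₂ (splits a) (λ x y → F x y c)) ≡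
  ∑₂ (splits m) (λ x b → ∑₂ (splits b) (λ y c → F x y c))
∑-splits-assoc [] F = refl
∑-splits-assoc (e ∷ m) F = begin
  ∑₂ (splits (e ∷ m)) (λ a c → ∑₂ (splits a) (λ x y → F x y c))
    ≡⟨ ∑-splits-∷ e m _ ⟩
  ∑₂ (anti e) (λ i l → ∑₂ (splits m) (λ a c → ∑₂ (splits (i ∷ a)) (λ x y → F x y (l ∷ c))))
    ≡⟨ ℤΣ.∑-cong (anti e) (λ p → trans
         (ℤΣ.∑-cong (splits m) (λ q → ∑-splits-∷ (proj₁ p) (proj₁ q) _))
         (ℤΣ.∑-swap (splits m) (anti (proj₁ p)) _)) ⟩
  ∑₂ (anti e) (λ i l → ∑₂ (anti i) (λ j k → ∑₂ (splits m) (λ a c →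
    ∑₂ (splits a) (λ x y → F (j ∷ x) (k ∷ y) (l ∷ c)))))
    ≡⟨ ∑-anti-assoc e (λ j k l → ∑₂ (splits m) (λ a c → ∑₂ (splits a) (λ x y → F (j ∷ x) (k ∷ y) (l ∷ c)))) ⟩
  ∑₂ (anti e) (λ j n → ∑₂ (anti n) (λ k l → ∑₂ (splits m) (λ a c →
    ∑₂ (splits a) (λ x y → F (j ∷ x) (k ∷ y) (l ∷ c)))))
    ≡⟨ ℤΣ.∑-cong (anti e) (λ p → ℤΣ.∑-cong (anti (proj₂ p)) (λ q → ∑-splits-assoc m _)) ⟩
  ∑₂ (anti e) (λ j n → ∑₂ (anti n) (λ k l → ∑₂ (splits m) (λ x b →
    ∑₂ (splits b) (λ y c → F (j ∷ x) (k ∷ y) (l ∷ c)))))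
    ≡⟨ ℤΣ.∑-cong (anti e) (λ p → trans
         (sym (ℤΣ.∑-swap (splits m) (anti (proj₂ p)) _))
         (ℤΣ.∑-cong (splits m) (λ q → sym (∑-splits-∷ (proj₂ p) (proj₂ q) _)))) ⟩
  ∑₂ (anti e) (λ j n → ∑₂ (splits m) (λ x b → ∑₂ (splits (n ∷ b)) (λ y c → F (j ∷ x) y c)))
    ≡⟨ ∑-splits-∷ e m _ ⟨
  ∑₂ (splits (e ∷ m)) (λ x b → ∑₂ (splits b) (λ y c → F x y c)) ∎
  where open ≡.≡-Reasoning

*P-eval : ∀ {k} (f g : Poly k) m → (f *P g) m ≡ ∑₂ (splits m) (λ a b → f a *ᶻ g b)
*P-eval f g m = cong (foldr _+ᶻ_ 0ℤ) (ListP.map-cong (λ _ → refl) (splits m))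

constP-zero : ∀ {k} (m : Mon k) → constP 0ℤ m ≡ 0ℤ
constP-zero {k} m with ≡-dec ℕP._≟_ m (replicate k 0)
... | yes _ = refl
... | no  _ = refl

constP-at : ∀ {k} z → constP {k} z (replicate k 0) ≡ z
constP-at {k} z with ≡-dec ℕP._≟_ (replicate k 0) (replicate k 0)
... | yes _ = refl
... | no ne = ⊥-elim (ne refl)

constP-off : ∀ {k} z {m : Mon k} → m ≢ replicate k 0 → constP z m ≡ 0ℤ
constP-off {k} z {m} ne with ≡-dec ℕP._≟_ m (replicate k 0)
... | yes e = ⊥-elim (ne e)
... | no  _ = refl

constP-∷ : ∀ {k} z (m : Mon k) → constP z (0 ∷ m) ≡ constP z m
constP-∷ {k} z m = by (≡-dec ℕP._≟_ m (replicate k 0))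
  where
  by : Dec (m ≡ replicate k 0) → constP z (0 ∷ m) ≡ constP z m
  by (yes refl) = trans (constP-at {suc k} z) (sym (constP-at {k} z))
  by (no ne) = trans (constP-off z (λ e → ne (cong Vec.tail e))) (sym (constP-off z ne))

∑-splits-constP : ∀ {k} z (G : Mon k → ℤ) (m : Mon k) →
  ∑₂ (splits m) (λ a b → constP z a *ᶻ G b) ≡ z *ᶻ G m
∑-splits-constP z G [] = ℤP.+-identityʳ _
∑-splits-constP {suc k} z G (e ∷ m) = begin
  ∑₂ (splits (e ∷ m)) (λ a b → constP z a *ᶻ G b)
    ≡⟨ ∑-splits-∷ e m _ ⟩
  ∑₂ (anti e) (λ i j → ∑₂ (splits m) (λ a b → constP z (i ∷ a) *ᶻ G (j ∷ b)))
    ≡⟨ ∑-anti-head e _ (λ i j → ℤΣ.∑-zero (splits m) (λ q →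
         cong (_*ᶻ G (j ∷ proj₂ q)) (constP-off z {suc i ∷ proj₁ q} (λ ())))) ⟩
  ∑₂ (splits m) (λ a b → constP z (0 ∷ a) *ᶻ G (e ∷ b))
    ≡⟨ ℤΣ.∑-cong (splits m) (λ q → cong (_*ᶻ G (e ∷ proj₂ q)) (constP-∷ z (proj₁ q))) ⟩
  ∑₂ (splits m) (λ a b → constP z a *ᶻ G (e ∷ b))
    ≡⟨ ∑-splits-constP z (λ b → G (e ∷ b)) m ⟩
  z *ᶻ G (e ∷ m) ∎
  where open ≡.≡-Reasoning

-- An inert copy of _≈P_ from which Agda can infer the two polynomials.
record _≋_ {k} (f g : Poly k) : Set where
  constructor mk
  field at : f ≈P g
open _≋_ public

infix 4 _≋_

≋-refl : ∀ {k} {f : Poly k} → f ≋ f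
≋-refl = mk λ _ → refl

*P-cong : ∀ {k} {f f′ g g′ : Poly k} → f ≋ f′ → g ≋ g′ → f *P g ≋ f′ *P g′
*P-cong {f = f} {f′} {g} {g′} p q = mk λ m → trans (*P-eval f g m)
  (trans (ℤΣ.∑-cong (splits m) (λ x → cong₂ _*ᶻ_ (at p (proj₁ x)) (at q (proj₂ x)))) (sym (*P-eval f′ g′ m)))

*P-comm : ∀ {k} (f g : Poly k) → f *P g ≋ g *P f
*P-comm f g = mk λ m → trans (*P-eval f g m) (trans (∑-splits-comm m _)
  (trans (ℤΣ.∑-cong (splits m) (λ x → ℤP.*-comm (f (proj₂ x)) (g (proj₁ x)))) (sym (*P-eval g f m))))

*P-assoc : ∀ {k} (f g h : Poly k) → (f *P g) *P h ≋ f *P (g *P h)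
*P-assoc f g h = mk λ m → begin
  ((f *P g) *P h) m
    ≡⟨ *P-eval (f *P g) h m ⟩
  ∑₂ (splits m) (λ a c → (f *P g) a *ᶻ h c)
    ≡⟨ ℤΣ.∑-cong (splits m) (λ p → trans (cong (_*ᶻ h (proj₂ p)) (*P-eval f g (proj₁ p)))
         (ℤΣ.∑-⊗ʳ (h (proj₂ p)) (splits (proj₁ p)) _)) ⟩
  ∑₂ (splits m) (λ a c → ∑₂ (splits a) (λ x y → f x *ᶻ g y *ᶻ h c))
    ≡⟨ ∑-splits-assoc m (λ x y c → f x *ᶻ g y *ᶻ h c) ⟩
  ∑₂ (splits m) (λ x b → ∑₂ (splits b) (λ y c → f x *ᶻ g y *ᶻ h c))
    ≡⟨ ℤΣ.∑-cong (splits m) (λ p → trans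
         (ℤΣ.∑-cong (splits (proj₂ p)) (λ q → ℤP.*-assoc (f (proj₁ p)) (g (proj₁ q)) (h (proj₂ q))))
         (trans (sym (ℤΣ.∑-⊗ˡ (f (proj₁ p)) (splits (proj₂ p)) _))
           (cong (f (proj₁ p) *ᶻ_) (sym (*P-eval g h (proj₂ p)))))) ⟩
  ∑₂ (splits m) (λ x b → f x *ᶻ (g *P h) b)
    ≡⟨ *P-eval f (g *P h) m ⟨
  (f *P (g *P h)) m ∎
  where open ≡.≡-Reasoning

constP-*P : ∀ {k} z (f : Poly k) m → (constP z *P f) m ≡ z *ᶻ f m
constP-*P z f m = trans (*P-eval (constP z) f m) (∑-splits-constP z f m)

infixl 6 _⊞_
infixl 7 _⊠_

-- Opaque copies of the operations: otherwise Agda unfolds a polynomial to its coefficients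
-- and can no longer infer the factors of a product.
opaque
  _⊞_ _⊠_ : ∀ {k} → Poly k → Poly k → Poly k
  _⊞_ = _+P_
  _⊠_ = _*P_

  cst : ∀ {k} → ℤ → Poly k
  cst = constP

  +P≋⊞ : ∀ {k} (f g : Poly k) → f +P g ≋ f ⊞ g
  +P≋⊞ f g = ≋-refl

  *P≋⊠ : ∀ {k} (f g : Poly k) → f *P g ≋ f ⊠ g
  *P≋⊠ f g = ≋-refl

  constP≋cst : ∀ {k} z → constP {k} z ≋ cst z
  constP≋cst z = ≋-refl

  ⊠-isCommutativeSemiring : ∀ k → IsCommutativeSemiring (_≋_ {k}) _⊞_ _⊠_ (cst 0ℤ) (cst 1ℤ)
  ⊠-isCommutativeSemiring k = isCommutativeSemiringˡ record
    { +-isCommutativeMonoid = isCommutativeMonoidˡ record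
      { isSemigroup = record
        { isMagma = record
          { isEquivalence = eqv
          ; ∙-cong = λ p q → mk λ m → cong₂ _+ᶻ_ (at p m) (at q m) }
        ; assoc = λ f g h → mk λ m → ℤP.+-assoc (f m) (g m) (h m) }
      ; identityˡ = λ f → mk λ m → trans (cong (_+ᶻ f m) (constP-zero m)) (ℤP.+-identityˡ (f m))
      ; comm = λ f g → mk λ m → ℤP.+-comm (f m) (g m) }
    ; *-isCommutativeMonoid = isCommutativeMonoidˡ record
      { isSemigroup = record
        { isMagma = record { isEquivalence = eqv ; ∙-cong = *P-cong }
        ; assoc = *P-assoc }
      ; identityˡ = λ f → mk λ m → trans (constP-*P 1ℤ f m) (ℤP.*-identityˡ (f m))
      ; comm = *P-comm }
    ; distribʳ = λ h f g → mk λ m → begin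
        ((f +P g) *P h) m
          ≡⟨ *P-eval (f +P g) h m ⟩
        ∑₂ (splits m) (λ a b → (f a +ᶻ g a) *ᶻ h b)
          ≡⟨ ℤΣ.∑-cong (splits m) (λ p → ℤP.*-distribʳ-+ (h (proj₂ p)) (f (proj₁ p)) (g (proj₁ p))) ⟩
        ∑₂ (splits m) (λ a b → f a *ᶻ h b +ᶻ g a *ᶻ h b)
          ≡⟨ ℤΣ.∑-⊕ (splits m) _ _ ⟩
        ∑₂ (splits m) (λ a b → f a *ᶻ h b) +ᶻ ∑₂ (splits m) (λ a b → g a *ᶻ h b)
          ≡⟨ cong₂ _+ᶻ_ (*P-eval f h m) (*P-eval g h m) ⟨
        (f *P h) m +ᶻ (g *P h) m ∎
    ; zeroˡ = λ f → mk λ m → trans (constP-*P 0ℤ f m) (sym (constP-zero m)) }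
    where
    open ≡.≡-Reasoning
    eqv : IsEquivalence (_≋_ {k})
    eqv = record
      { refl = ≋-refl
      ; sym = λ p → mk λ m → sym (at p m)
      ; trans = λ p q → mk λ m → trans (at p m) (at q m) }

PolyR : ℕ → CommutativeSemiring 0ℓ 0ℓ
PolyR k = record
  { Carrier = Poly k ; _≈_ = _≋_ ; _+_ = _⊞_ ; _*_ = _⊠_ ; 0# = cst 0ℤ ; 1# = cst 1ℤ
  ; isCommutativeSemiring = ⊠-isCommutativeSemiring k }

module PR {k} = CommutativeSemiring (PolyR k)
module PΣ {k} = Sums (PolyR k)
open PΣ using () renaming (∑ to ∑ᴾ; ∑₂ to ∑₂ᴾ)

opaque
  unfolding _⊞_

  ∑ᴾ-eval : ∀ {k} {A : Set} (xs : List A) (F : A → Poly k) m → ∑ᴾ xs F m ≡ ∑ xs (λ x → F x m)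
  ∑ᴾ-eval [] F m = constP-zero m
  ∑ᴾ-eval (x ∷ xs) F m = cong (F x m +ᶻ_) (∑ᴾ-eval xs F m)

≋-by-constant-term : ∀ {k} (F G : Poly k) → F (replicate k 0) ≡ G (replicate k 0) →
  (∀ m → m ≢ replicate k 0 → F m ≡ G m) → F ≋ G
≋-by-constant-term {k} F G e₀ e = mk λ m → by m (≡-dec ℕP._≟_ m (replicate k 0))
  where
  by : ∀ m → Dec (m ≡ replicate k 0) → F m ≡ G m
  by m (yes refl) = e₀
  by m (no ne) = e m ne

opaque
  unfolding _⊞_

  cst-+ : ∀ {k} a b → cst {k} (a +ᶻ b) ≋ cst a ⊞ cst b
  cst-+ {k} a b = ≋-by-constant-term _ _
    (trans (constP-at {k} _) (sym (cong₂ _+ᶻ_ (constP-at {k} a) (constP-at {k} b))))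
    (λ m ne → trans (constP-off _ ne) (sym (cong₂ _+ᶻ_ (constP-off a ne) (constP-off b ne))))

  cst-* : ∀ {k} a b → cst {k} (a *ᶻ b) ≋ cst a ⊠ cst b
  cst-* {k} a b = ≋-by-constant-term _ _
    (trans (constP-at {k} _) (sym (trans (constP-*P a (constP b) _) (cong (a *ᶻ_) (constP-at {k} b)))))
    (λ m ne → trans (constP-off _ ne) (sym (trans (constP-*P a (constP b) m)
      (trans (cong (a *ᶻ_) (constP-off b ne)) (ℤP.*-zeroʳ a)))))

-- Homogeneous components

-- A Kronecker delta carrying a value. Recursion on both indices, in place of a decision, lets a
-- common shift compute away.
δ : ℕ → ℕ → ℤ → ℤ
δ zero zero x = x
δ zero (suc e) x = 0ℤ
δ (suc p) zero x = 0ℤ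
δ (suc p) (suc e) x = δ p e x

δ-refl : ∀ p x → δ p p x ≡ x
δ-refl zero x = refl
δ-refl (suc p) x = δ-refl p x

δ-≢ : ∀ {p e} x → p ≢ e → δ p e x ≡ 0ℤ
δ-≢ {zero} {zero} x ne = ⊥-elim (ne refl)
δ-≢ {zero} {suc e} x ne = refl
δ-≢ {suc p} {zero} x ne = refl
δ-≢ {suc p} {suc e} x ne = δ-≢ x (λ q → ne (cong suc q))

δ-zero : ∀ p e → δ p e 0ℤ ≡ 0ℤ
δ-zero zero zero = refl
δ-zero zero (suc e) = refl
δ-zero (suc p) zero = refl
δ-zero (suc p) (suc e) = δ-zero p e

δ-+ : ∀ p e x y → δ p e (x +ᶻ y) ≡ δ p e x +ᶻ δ p e y
δ-+ zero zero x y = refl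
δ-+ zero (suc e) x y = refl
δ-+ (suc p) zero x y = refl
δ-+ (suc p) (suc e) x y = δ-+ p e x y

δ-*ʳ : ∀ p e x y → x *ᶻ δ p e y ≡ δ p e (x *ᶻ y)
δ-*ʳ zero zero x y = refl
δ-*ʳ zero (suc e) x y = ℤP.*-zeroʳ x
δ-*ʳ (suc p) zero x y = ℤP.*-zeroʳ x
δ-*ʳ (suc p) (suc e) x y = δ-*ʳ p e x y

δ-∑ : ∀ {A : Set} p e (xs : List A) (f : A → ℤ) → δ p e (∑ xs f) ≡ ∑ xs (λ x → δ p e (f x))
δ-∑ p e [] f = δ-zero p e
δ-∑ p e (x ∷ xs) f = trans (δ-+ p e (f x) (∑ xs f)) (cong (δ p e (f x) +ᶻ_) (δ-∑ p e xs f))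

-- In terms of generating functions: the coefficient of t^e in the product of x t^p and y t^q.
∑-anti-δ : ∀ e p q x y → ∑₂ (anti e) (λ i j → δ p i x *ᶻ δ q j y) ≡ δ (p + q) e (x *ᶻ y)
∑-anti-δ e zero q x y = trans (∑-anti-head e (λ i j → δ 0 i x *ᶻ δ q j y) (λ _ _ → refl)) (δ-*ʳ q e x y)
∑-anti-δ zero (suc p) q x y = refl
∑-anti-δ (suc e) (suc p) q x y = trans (∑-anti-suc e (λ i j → δ (suc p) i x *ᶻ δ q j y))
  (trans (ℤP.+-identityˡ (∑₂ (anti e) (λ i j → δ p i x *ᶻ δ q j y))) (∑-anti-δ e p q x y))

∑-upTo-δ : ∀ n p x → p < n → ∑ (upTo n) (λ e → δ p e x) ≡ x
∑-upTo-δ (suc n) zero x _ = trans (ℤΣ.∑-upTo-suc n (λ e → δ 0 e x))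
  (trans (cong (x +ᶻ_) (ℤΣ.∑-zero (upTo n) (λ _ → refl))) (ℤP.+-identityʳ x))
∑-upTo-δ (suc n) (suc p) x (s≤s p<n) = trans (ℤΣ.∑-upTo-suc n (λ e → δ (suc p) e x))
  (trans (ℤP.+-identityˡ _) (∑-upTo-δ n p x p<n))

H : ∀ {k} → ℕ → Poly k → Poly k
H e f m = δ ∣ m ∣ₘ e (f m)

H-+ : ∀ {k} e (f g : Poly k) → H e (f +P g) ≋ H e f ⊞ H e g
H-+ e f g = PR.trans (mk λ m → δ-+ ∣ m ∣ₘ e (f m) (g m)) (+P≋⊞ (H e f) (H e g))

-- The condition on the degree of m is moved into each single split, where the degrees of a and b
-- sum to it; there `∑-anti-δ` distributes it over the pairs (i, j).
H-* : ∀ {k} e (f g : Poly k) → H e (f *P g) ≋ ∑₂ᴾ (anti e) (λ i j → H i f ⊠ H j g)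
H-* e f g = mk λ m → begin
  δ ∣ m ∣ₘ e ((f *P g) m)
    ≡⟨ cong (δ ∣ m ∣ₘ e) (*P-eval f g m) ⟩
  δ ∣ m ∣ₘ e (∑₂ (splits m) (λ a b → f a *ᶻ g b))
    ≡⟨ δ-∑ ∣ m ∣ₘ e (splits m) (λ p → f (proj₁ p) *ᶻ g (proj₂ p)) ⟩
  ∑₂ (splits m) (λ a b → δ ∣ m ∣ₘ e (f a *ᶻ g b))
    ≡⟨ ∑-splits-cong m (λ a b eq → trans (cong (λ t → δ t e (f a *ᶻ g b)) (sym eq))
         (sym (∑-anti-δ e ∣ a ∣ₘ ∣ b ∣ₘ (f a) (g b)))) ⟩
  ∑₂ (splits m) (λ a b → ∑₂ (anti e) (λ i j → H i f a *ᶻ H j g b))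
    ≡⟨ ℤΣ.∑-swap (splits m) (anti e) (λ p q → H (proj₁ q) f (proj₁ p) *ᶻ H (proj₂ q) g (proj₂ p)) ⟩
  ∑₂ (anti e) (λ i j → ∑₂ (splits m) (λ a b → H i f a *ᶻ H j g b))
    ≡⟨ ℤΣ.∑-cong (anti e) (λ q → *P-eval (H (proj₁ q) f) (H (proj₂ q) g) m) ⟨
  ∑₂ (anti e) (λ i j → (H i f *P H j g) m)
    ≡⟨ ℤΣ.∑-cong (anti e) (λ q → at (*P≋⊠ (H (proj₁ q) f) (H (proj₂ q) g)) m) ⟩
  ∑₂ (anti e) (λ i j → (H i f ⊠ H j g) m)
    ≡⟨ ∑ᴾ-eval (anti e) (λ q → H (proj₁ q) f ⊠ H (proj₂ q) g) m ⟨
  ∑₂ᴾ (anti e) (λ i j → H i f ⊠ H j g) m ∎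
  where open ≡.≡-Reasoning

∣0∣ₘ : ∀ k → ∣ replicate k 0 ∣ₘ ≡ 0
∣0∣ₘ zero = refl
∣0∣ₘ (suc k) = ∣0∣ₘ k

∣m∣≡0⇒m≡0 : ∀ {k} (m : Mon k) → ∣ m ∣ₘ ≡ 0 → m ≡ replicate k 0
∣m∣≡0⇒m≡0 [] _ = refl
∣m∣≡0⇒m≡0 (zero ∷ m) e = cong (0 ∷_) (∣m∣≡0⇒m≡0 m e)

H-0 : ∀ {k} (f : Poly k) → H 0 f ≋ cst (f (replicate k 0))
H-0 {k} f = PR.trans (≋-by-constant-term _ _
  (trans (cong (λ t → δ t 0 (f (replicate k 0))) (∣0∣ₘ k)) (sym (constP-at {k} _)))
  (λ m ne → trans (δ-≢ (f m) (λ e → ne (∣m∣≡0⇒m≡0 m e))) (sym (constP-off _ ne)))) (constP≋cst _)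

H-constP : ∀ {k} e z → H (suc e) (constP {k} z) ≋ cst 0ℤ
H-constP {k} e z = PR.trans (≋-by-constant-term _ _
  (trans (cong (λ t → δ t (suc e) (constP z (replicate k 0))) (∣0∣ₘ k)) (sym (constP-zero {k} _)))
  (λ m ne → trans (cong (δ ∣ m ∣ₘ (suc e)) (constP-off z ne)) (trans (δ-zero ∣ m ∣ₘ (suc e)) (sym (constP-zero m))))) (constP≋cst 0ℤ)

varP-off : ∀ {k} (i : Fin k) {m} → m ≢ replicate k 0 [ i ]≔ 1 → varP i m ≡ 0ℤ
varP-off {k} i {m} ne with ≡-dec ℕP._≟_ m (replicate k 0 [ i ]≔ 1)
... | yes e = ⊥-elim (ne e)
... | no  _ = refl

∣x∣ₘ : ∀ {k} (i : Fin k) → ∣ replicate k 0 [ i ]≔ 1 ∣ₘ ≡ 1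
∣x∣ₘ {suc k} zero = cong suc (∣0∣ₘ k)
∣x∣ₘ {suc k} (suc i) = ∣x∣ₘ i

varP-supp : ∀ {k} (i : Fin k) m → ∣ m ∣ₘ ≢ 1 → varP i m ≡ 0ℤ
varP-supp i m ne = varP-off i (λ e → ne (trans (cong ∣_∣ₘ e) (∣x∣ₘ i)))

H-varP : ∀ {k} (i : Fin k) → H 1 (varP i) ≋ varP i
H-varP i = mk λ m → by m (∣ m ∣ₘ ℕP.≟ 1)
  where
  by : ∀ m → Dec (∣ m ∣ₘ ≡ 1) → δ ∣ m ∣ₘ 1 (varP i m) ≡ varP i m
  by m (yes e) = trans (cong (λ t → δ t 1 (varP i m)) e) refl
  by m (no ne) = trans (δ-≢ _ ne) (sym (varP-supp i m ne))

H-varP-high : ∀ {k} e (i : Fin k) → H (suc (suc e)) (varP i) ≋ cst 0ℤ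
H-varP-high e i = PR.trans (mk λ m → trans (by m (∣ m ∣ₘ ℕP.≟ 1)) (sym (constP-zero m))) (constP≋cst 0ℤ)
  where
  by : ∀ m → Dec (∣ m ∣ₘ ≡ 1) → δ ∣ m ∣ₘ (suc (suc e)) (varP i m) ≡ 0ℤ
  by m (yes q) = cong (λ t → δ t (suc (suc e)) (varP i m)) q
  by m (no ne) = trans (cong (δ ∣ m ∣ₘ (suc (suc e))) (varP-supp i m ne)) (δ-zero ∣ m ∣ₘ (suc (suc e)))

∑-H : ∀ {k} d (f : Poly k) → (∀ m → d < ∣ m ∣ₘ → f m ≡ 0ℤ) → f ≋ ∑ᴾ (upTo (suc d)) (λ e → H e f)
∑-H d f h = mk λ m → sym (trans (∑ᴾ-eval (upTo (suc d)) (λ e → H e f) m) (by m (∣ m ∣ₘ ℕP.≤? d)))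
  where
  by : ∀ m → Dec (∣ m ∣ₘ ≤ d) → ∑ (upTo (suc d)) (λ e → δ ∣ m ∣ₘ e (f m)) ≡ f m
  by m (yes p) = ∑-upTo-δ (suc d) ∣ m ∣ₘ (f m) (s≤s p)
  by m (no np) = trans (ℤΣ.∑-zero (upTo (suc d)) (λ e → trans (cong (δ ∣ m ∣ₘ e) z) (δ-zero ∣ m ∣ₘ e))) (sym z)
    where z = h m (ℕP.≰⇒> np)

∑-splits-0 : ∀ k (F : Mon k → Mon k → ℤ) → ∑₂ (splits (replicate k 0)) F ≡ F (replicate k 0) (replicate k 0)
∑-splits-0 zero F = ℤP.+-identityʳ _
∑-splits-0 (suc k) F = trans (∑-splits-∷ 0 (replicate k 0) F)
  (trans (ℤP.+-identityʳ _) (∑-splits-0 k (λ a b → F (0 ∷ a) (0 ∷ b))))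

*P-at-0 : ∀ {k} (f g : Poly k) → (f *P g) (replicate k 0) ≡ f (replicate k 0) *ᶻ g (replicate k 0)
*P-at-0 {k} f g = trans (*P-eval f g (replicate k 0)) (∑-splits-0 k (λ a b → f a *ᶻ g b))

-- Circuits as arrays of gates

liftGate : ∀ {k s} → Gate k s → Gate k (suc s)
liftGate (input-var x) = input-var x
liftGate (input-cst c) = input-cst c
liftGate (add a b) = add (suc a) (suc b)
liftGate (mul a b) = mul (suc a) (suc b)

-- In a `Circuit` each gate numbers its children relative to its own tail. Renumbering them from the
-- output puts all gates into one index type, as stacks require.
gateAt : ∀ {k s} → Circuit k s → Fin s → Gate k s
gateAt (g ∷ C) zero = liftGate g
gateAt (g ∷ C) (suc i) = liftGate (gateAt C i)

gateVal : ∀ {k s} → (Fin s → Poly k) → Gate k s → Poly k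
gateVal v (input-var x) = varP x
gateVal v (input-cst c) = constP (constVal c)
gateVal v (add a b) = v a +P v b
gateVal v (mul a b) = v a *P v b

gateDeg : ∀ {k s} → (Fin s → ℕ) → Gate k s → ℕ
gateDeg v (input-var x) = 1
gateDeg v (input-cst c) = 1
gateDeg v (add a b) = v a ⊔ v b
gateDeg v (mul a b) = v a + v b

ChildrenAfter : ∀ {k s} → ℕ → Gate k s → Set
ChildrenAfter t (input-var x) = ⊤
ChildrenAfter t (input-cst c) = ⊤
ChildrenAfter t (add a b) = t < toℕ a × t < toℕ b
ChildrenAfter t (mul a b) = t < toℕ a × t < toℕ b

valAt : ∀ {k s} → Circuit k s → Fin s → Poly k
valAt C = lookup (values C)

degAt : ∀ {k s} → Circuit k s → Fin s → ℕ
degAt C = lookup (fdegs C)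

valAt-gate : ∀ {k s} (C : Circuit k s) i → valAt C i ≡ gateVal (valAt C) (gateAt C i)
valAt-gate (input-var x ∷ C) zero = refl
valAt-gate (input-cst c ∷ C) zero = refl
valAt-gate (add a b ∷ C) zero = refl
valAt-gate (mul a b ∷ C) zero = refl
valAt-gate (g ∷ C) (suc i) = trans (valAt-gate C i) (lifted (gateAt C i))
  where
  lifted : ∀ h → gateVal (valAt C) h ≡ gateVal (valAt (g ∷ C)) (liftGate h)
  lifted (input-var x) = refl
  lifted (input-cst c) = refl
  lifted (add a b) = refl
  lifted (mul a b) = refl

degAt-gate : ∀ {k s} (C : Circuit k s) i → degAt C i ≡ gateDeg (degAt C) (gateAt C i)
degAt-gate (input-var x ∷ C) zero = refl
degAt-gate (input-cst c ∷ C) zero = refl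
degAt-gate (add a b ∷ C) zero = refl
degAt-gate (mul a b ∷ C) zero = refl
degAt-gate (g ∷ C) (suc i) = trans (degAt-gate C i) (lifted (gateAt C i))
  where
  lifted : ∀ h → gateDeg (degAt C) h ≡ gateDeg (degAt (g ∷ C)) (liftGate h)
  lifted (input-var x) = refl
  lifted (input-cst c) = refl
  lifted (add a b) = refl
  lifted (mul a b) = refl

gateAt-children : ∀ {k s} (C : Circuit k s) i → ChildrenAfter (toℕ i) (gateAt C i)
gateAt-children (input-var x ∷ C) zero = tt
gateAt-children (input-cst c ∷ C) zero = tt
gateAt-children (add a b ∷ C) zero = s≤s z≤n , s≤s z≤n
gateAt-children (mul a b ∷ C) zero = s≤s z≤n , s≤s z≤n
gateAt-children (g ∷ C) (suc i) = lifted (gateAt C i) (gateAt-children C i)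
  where
  lifted : ∀ h → ChildrenAfter (toℕ i) h → ChildrenAfter (suc (toℕ i)) (liftGate h)
  lifted (input-var x) p = tt
  lifted (input-cst c) p = tt
  lifted (add a b) (p , q) = s≤s p , s≤s q
  lifted (mul a b) (p , q) = s≤s p , s≤s q

-- Children have larger indices, so induction runs on how far a gate is from the end.
gate-induction : ∀ {s} (P : Fin s → Set) →
  (∀ i → (∀ j → toℕ i < toℕ j → P j) → P i) → ∀ i → P i
gate-induction {s} P step i = go s i (ℕP.m≤m+n s (toℕ i))
  where
  go : ∀ h i → s ≤ h + toℕ i → P i
  go zero i le = ⊥-elim (ℕP.<⇒≱ (FinP.toℕ<n i) le)
  go (suc h) i le = step i (λ j lt → go h j (ℕP.≤-trans le
    (ℕP.≤-trans (ℕP.≤-reflexive (sym (ℕP.+-suc h (toℕ i)))) (ℕP.+-monoʳ-≤ h lt))))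

-- Needed in `N-step`, where one more level must enlarge the exponent by at least one unit.
degAt-pos : ∀ {k s} (C : Circuit k s) i → 1 ≤ degAt C i
degAt-pos C = gate-induction _ λ i ih →
  subst (1 ≤_) (sym (degAt-gate C i)) (by i ih (gateAt C i) (gateAt-children C i))
  where
  by : ∀ i → (∀ j → toℕ i < toℕ j → 1 ≤ degAt C j) → ∀ g → ChildrenAfter (toℕ i) g → 1 ≤ gateDeg (degAt C) g
  by i ih (input-var x) _ = s≤s z≤n
  by i ih (input-cst c) _ = s≤s z≤n
  by i ih (add a b) (p , _) = ℕP.≤-trans (ih a p) (ℕP.m≤m⊔n _ _)
  by i ih (mul a b) (p , _) = ℕP.≤-trans (ih a p) (ℕP.m≤m+n _ _)

-- The formal degree bounds the degree

VanishesAbove : ∀ {k} → ℕ → Poly k → Set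
VanishesAbove D f = ∀ m → D < ∣ m ∣ₘ → f m ≡ 0ℤ

*P-vanishes : ∀ {k} {p q} {f g : Poly k} → VanishesAbove p f → VanishesAbove q g → VanishesAbove (p + q) (f *P g)
*P-vanishes {p = p} {q} {f} {g} vf vg m lt = trans (*P-eval f g m)
  (trans (∑-splits-cong m (λ a b eq → by a b eq (p ℕP.<? ∣ a ∣ₘ))) (ℤΣ.∑-zero (splits m) (λ _ → refl)))
  where
  by : ∀ a b → ∣ a ∣ₘ + ∣ b ∣ₘ ≡ ∣ m ∣ₘ → Dec (p < ∣ a ∣ₘ) → f a *ᶻ g b ≡ 0ℤ
  by a b eq (yes p<a) = cong (_*ᶻ g b) (vf a p<a)
  by a b eq (no p≮a) = trans (cong (f a *ᶻ_) (vg b (ℕP.≰⇒> λ b≤q →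
    ℕP.<⇒≱ lt (subst (_≤ p + q) eq (ℕP.+-mono-≤ (ℕP.≮⇒≥ p≮a) b≤q))))) (ℤP.*-zeroʳ (f a))

valAt-vanishes : ∀ {k s} (C : Circuit k s) i → VanishesAbove (degAt C i) (valAt C i)
valAt-vanishes {k} C = gate-induction _ λ i ih → ≡.subst₂ VanishesAbove (sym (degAt-gate C i)) (sym (valAt-gate C i))
  (by i ih (gateAt C i) (gateAt-children C i))
  where
  by : ∀ i → (∀ j → toℕ i < toℕ j → VanishesAbove (degAt C j) (valAt C j)) → ∀ g → ChildrenAfter (toℕ i) g →
       VanishesAbove (gateDeg (degAt C) g) (gateVal (valAt C) g)
  by i ih (input-var x) _ m lt = varP-supp x m (λ e → ℕP.<⇒≢ lt (sym e))
  by i ih (input-cst c) _ m lt = constP-off (constVal c) {m} (λ { refl → ℕP.n≮0 (subst (1 <_) (∣0∣ₘ k) lt) })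
  by i ih (add a b) (p , q) m lt = cong₂ _+ᶻ_
    (ih a p m (ℕP.≤-<-trans (ℕP.m≤m⊔n _ _) lt)) (ih b q m (ℕP.≤-<-trans (ℕP.m≤n⊔m (degAt C a) _) lt))
  by i ih (mul a b) (p , q) = *P-vanishes (ih a p) (ih b q)

-- The stack machine

n<2^n : ∀ n → n < 2 ^ n
n<2^n zero = s≤s z≤n
n<2^n (suc n) = ℕP.+-mono-≤ (ℕP.m^n>0 2 n) (ℕP.≤-trans (n<2^n n) (ℕP.m≤m+n _ 0))

leafPoly : ∀ {k} → Leaf k → Poly k
leafPoly (var x) = varP x
leafPoly (num z) = cst z

-- The default 0 is harmless: the machine emits variable gates only, so a word with any other letter
-- has coefficient 0 anyway.
gateLeaf : ∀ {k s} → Gate k s → Leaf k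
gateLeaf (input-var x) = var x
gateLeaf _ = num 0ℤ

module _ {A : Set} where

  sum-concatMap-≤ : ∀ {B : Set} (w : B → ℕ) (f : A → List B) (c : A → ℕ) {xs} →
    All (λ x → sum (map w (f x)) ≤ c x) xs → sum (map w (concatMap f xs)) ≤ sum (map c xs)
  sum-concatMap-≤ w f c [] = z≤n
  sum-concatMap-≤ w f c (_∷_ {x} {xs} p ps) rewrite ListP.map-++ w (f x) (concatMap f xs)
    | sum-++ (map w (f x)) (map w (concatMap f xs)) = ℕP.+-mono-≤ p (sum-concatMap-≤ w f c ps)

  sum-map-const : ∀ (c : ℕ) (xs : List A) → sum (map (λ _ → c) xs) ≡ length xs * c
  sum-map-const c [] = refl
  sum-map-const c (x ∷ xs) = cong (c +_) (sum-map-const c xs)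

  sum-map-* : ∀ (c : ℕ) (w : A → ℕ) (xs : List A) → sum (map (λ x → c * w x) xs) ≡ c * sum (map w xs)
  sum-map-* c w [] = sym (ℕP.*-zeroʳ c)
  sum-map-* c w (x ∷ xs) = trans (cong (c * w x +_) (sum-map-* c w xs)) (sym (ℕP.*-distribˡ-+ c (w x) _))

-- `D` bounds the formal degree of the gates allowed on a stack. It is kept apart from the circuit
-- because gates that the output does not reach may have formal degree exponential in s.
module Machine {k s} (C : Circuit k s) (D d : ℕ) where

  Item Stack : Set
  Item = Fin s × ℕ
  Stack = List Item

  Entry : Set → Set
  Entry A = ℤ × A × Stack

  stack : ∀ {A} → Entry A → Stack
  stack t = proj₂ (proj₂ t)

  c₀ : Fin s → ℤ
  c₀ i = valAt C i (replicate k 0)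

  scale : ∀ {A : Set} → ℤ → List (Entry A) → List (Entry A)
  scale c = map (λ t → c *ᶻ proj₁ t , proj₂ t)

  mutual
    -- All ways to emit the next variable from gate i in degree e while S waits. The first argument
    -- is fuel: children have larger indices, so `s ≤ h + toℕ i` guarantees that the empty result at
    -- zero is never reached.
    expand : ℕ → Fin s → ℕ → Stack → List (Entry (Fin s))
    expand zero i e S = []
    expand (suc h) i e S = expandGate h (gateAt C i) i e S

    expandGate : ℕ → Gate k s → Fin s → ℕ → Stack → List (Entry (Fin s))
    expandGate h (input-var x) i 1 S = (1ℤ , i , S) ∷ []
    expandGate h (input-var x) i _ S = []
    expandGate h (input-cst c) i e S = []
    expandGate h (add a b) i e S = expand h a e S ++ expand h b e S
    expandGate h (mul a b) i e S = concatMap (λ p → expandMul h a b (proj₁ p) (proj₂ p) S) (anti e)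

    -- The factor of larger degree is deferred, so that the stack stays logarithmic in the degree.
    expandMul : ℕ → Fin s → Fin s → ℕ → ℕ → Stack → List (Entry (Fin s))
    expandMul h a b zero y S = scale (c₀ a) (expand h b y S)
    expandMul h a b (suc x) zero S = scale (c₀ b) (expand h a (suc x) S)
    expandMul h a b (suc x) (suc y) S with x ≤? y
    ... | yes _ = expand h a (suc x) ((b , suc y) ∷ S)
    ... | no  _ = expand h b (suc y) ((a , suc x) ∷ S)

  part : Fin s → ℕ → Poly k
  part i e = H e (valAt C i)

  ⟦_⟧ : Stack → Poly k
  ⟦ S ⟧ = foldr (λ u → uncurry part u ⊠_) (cst 1ℤ) S

  module Value {A : Set} (g : A → Poly k) where

    term : Entry A → Poly k
    term t = cst (proj₁ t) ⊠ (g (proj₁ (proj₂ t)) ⊠ ⟦ stack t ⟧)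

    ⟪_⟫ : List (Entry A) → Poly k
    ⟪ E ⟫ = ∑ᴾ E term

    ⟪scale⟫ : ∀ c E → ⟪ scale c E ⟫ ≋ cst c ⊠ ⟪ E ⟫
    ⟪scale⟫ c E = PR.trans (PΣ.∑-map _ E term) (PR.trans
      (PΣ.∑-cong E (λ t → PR.trans (PR.*-congʳ (cst-* c (proj₁ t))) (PR.*-assoc _ _ _)))
      (PR.sym (PΣ.∑-⊗ˡ (cst c) E term)))

  letter : Fin s → Poly k
  letter i = leafPoly (gateLeaf (gateAt C i))

  open Value letter

  open import Relation.Binary.Reasoning.Setoid (PR.setoid {k}) using (begin_; step-≈-⟩; step-≈-⟨; _∎)
  open import Algebra.Properties.CommutativeSemigroup (PR.*-commutativeSemigroup {k}) using (x∙yz≈y∙xz)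

  private
    fuel-step : ∀ {h} {i j : Fin s} → s ≤ suc h + toℕ i → toℕ i < toℕ j → s ≤ h + toℕ j
    fuel-step {h} {i} le lt = ℕP.≤-trans le
      (ℕP.≤-trans (ℕP.≤-reflexive (sym (ℕP.+-suc h (toℕ i)))) (ℕP.+-monoʳ-≤ h lt))

  mutual
    -- Restricted to positive degrees, since nothing is emitted at a constant gate. Degree 0 occurs
    -- only as a factor in `expandMul`, where `H-0` identifies it with the constant `c₀`.
    expand-sound : ∀ h i e S → s ≤ h + toℕ i → ⟪ expand h i (suc e) S ⟫ ≋ part i (suc e) ⊠ ⟦ S ⟧
    expand-sound zero i e S le = ⊥-elim (ℕP.<⇒≱ (FinP.toℕ<n i) le)
    expand-sound (suc h) i e S le = PR.trans
      (expandGate-sound h (gateAt C i) i e S le refl (gateAt-children C i))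
      (PR.*-congʳ (PR.reflexive (cong (H (suc e)) (sym (valAt-gate C i)))))

    expandGate-sound : ∀ h g i e S → s ≤ suc h + toℕ i → gateAt C i ≡ g → ChildrenAfter (toℕ i) g →
      ⟪ expandGate h g i (suc e) S ⟫ ≋ H (suc e) (gateVal (valAt C) g) ⊠ ⟦ S ⟧
    expandGate-sound h (input-var x) i zero S le eq _ = begin
      (cst 1ℤ ⊠ (letter i ⊠ ⟦ S ⟧)) ⊞ cst 0ℤ
        ≈⟨ PR.trans (PR.+-identityʳ _) (PR.*-identityˡ _) ⟩
      letter i ⊠ ⟦ S ⟧
        ≈⟨ PR.*-congʳ (PR.trans (PR.reflexive (cong (λ g → leafPoly (gateLeaf g)) eq)) (PR.sym (H-varP x))) ⟩
      H 1 (varP x) ⊠ ⟦ S ⟧ ∎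
    expandGate-sound h (input-var x) i (suc e) S le _ _ =
      PR.sym (PR.trans (PR.*-congʳ (H-varP-high e x)) (PR.zeroˡ _))
    expandGate-sound h (input-cst c) i e S le _ _ =
      PR.sym (PR.trans (PR.*-congʳ (H-constP e (constVal c))) (PR.zeroˡ _))
    expandGate-sound h (add a b) i e S le _ (p , q) = begin
      ⟪ expand h a (suc e) S ++ expand h b (suc e) S ⟫
        ≈⟨ PΣ.∑-++ (expand h a (suc e) S) _ term ⟩
      ⟪ expand h a (suc e) S ⟫ ⊞ ⟪ expand h b (suc e) S ⟫
        ≈⟨ PR.+-cong (expand-sound h a e S (fuel-step {h} le p)) (expand-sound h b e S (fuel-step {h} le q)) ⟩
      (part a (suc e) ⊠ ⟦ S ⟧) ⊞ (part b (suc e) ⊠ ⟦ S ⟧)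
        ≈⟨ PR.distribʳ _ _ _ ⟨
      (part a (suc e) ⊞ part b (suc e)) ⊠ ⟦ S ⟧
        ≈⟨ PR.*-congʳ (H-+ (suc e) (valAt C a) (valAt C b)) ⟨
      H (suc e) (valAt C a +P valAt C b) ⊠ ⟦ S ⟧ ∎
    expandGate-sound h (mul a b) i e S le _ (p , q) = begin
      ⟪ concatMap (λ r → expandMul h a b (proj₁ r) (proj₂ r) S) (anti (suc e)) ⟫
        ≈⟨ PΣ.∑-concatMap (λ r → expandMul h a b (proj₁ r) (proj₂ r) S) (anti (suc e)) term ⟩
      ∑₂ᴾ (anti (suc e)) (λ x y → ⟪ expandMul h a b x y S ⟫)
        ≈⟨ PΣ.∑-congᴬ (All.map (λ {r} eq → expandMul-sound h a b (proj₁ r) (proj₂ r) e S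
             (fuel-step {h} le p) (fuel-step {h} le q) eq) (anti-sum (suc e))) ⟩
      ∑₂ᴾ (anti (suc e)) (λ x y → (part a x ⊠ part b y) ⊠ ⟦ S ⟧)
        ≈⟨ PΣ.∑-⊗ʳ ⟦ S ⟧ (anti (suc e)) _ ⟨
      ∑₂ᴾ (anti (suc e)) (λ x y → part a x ⊠ part b y) ⊠ ⟦ S ⟧
        ≈⟨ PR.*-congʳ (H-* (suc e) (valAt C a) (valAt C b)) ⟨
      H (suc e) (valAt C a *P valAt C b) ⊠ ⟦ S ⟧ ∎

    expandMul-sound : ∀ h a b x y e S → s ≤ h + toℕ a → s ≤ h + toℕ b → x + y ≡ suc e →
      ⟪ expandMul h a b x y S ⟫ ≋ (part a x ⊠ part b y) ⊠ ⟦ S ⟧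
    expandMul-sound h a b zero (suc y) e S p q eq = begin
      ⟪ scale (c₀ a) (expand h b (suc y) S) ⟫
        ≈⟨ ⟪scale⟫ (c₀ a) (expand h b (suc y) S) ⟩
      cst (c₀ a) ⊠ ⟪ expand h b (suc y) S ⟫
        ≈⟨ PR.*-cong (PR.sym (H-0 (valAt C a))) (expand-sound h b y S q) ⟩
      part a 0 ⊠ (part b (suc y) ⊠ ⟦ S ⟧)
        ≈⟨ PR.*-assoc _ _ _ ⟨
      (part a 0 ⊠ part b (suc y)) ⊠ ⟦ S ⟧ ∎
    expandMul-sound h a b (suc x) zero e S p q eq = begin
      ⟪ scale (c₀ b) (expand h a (suc x) S) ⟫
        ≈⟨ ⟪scale⟫ (c₀ b) (expand h a (suc x) S) ⟩
      cst (c₀ b) ⊠ ⟪ expand h a (suc x) S ⟫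
        ≈⟨ PR.*-cong (PR.sym (H-0 (valAt C b))) (expand-sound h a x S p) ⟩
      part b 0 ⊠ (part a (suc x) ⊠ ⟦ S ⟧)
        ≈⟨ PR.trans (x∙yz≈y∙xz _ _ _) (PR.sym (PR.*-assoc _ _ _)) ⟩
      (part a (suc x) ⊠ part b 0) ⊠ ⟦ S ⟧ ∎
    expandMul-sound h a b (suc x) (suc y) e S p q eq with x ≤? y
    ... | yes _ = PR.trans (expand-sound h a x _ p) (PR.sym (PR.*-assoc _ _ _))
    ... | no  _ = PR.trans (expand-sound h b y _ q) (PR.trans (x∙yz≈y∙xz _ _ _) (PR.sym (PR.*-assoc _ _ _)))

  -- Domination of degrees and the length of stacks

  total : Stack → ℕ
  total S = sum (map proj₂ S)

  -- p is the sum of the degrees above S; each degree dominates the sum of those above it.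
  OK : ℕ → Stack → Set
  OK p [] = ⊤
  OK p ((i , e) ∷ S) = p ≤ e × 1 ≤ e × degAt C i ≤ D × OK (p + e) S

  OK? : ∀ p S → Dec (OK p S)
  OK? p [] = yes tt
  OK? p ((i , e) ∷ S) = (p ≤? e) ×-dec (1 ≤? e) ×-dec (degAt C i ≤? D) ×-dec OK? (p + e) S

  OK-antitone : ∀ {p q} S → p ≤ q → OK q S → OK p S
  OK-antitone [] p≤q ok = tt
  OK-antitone ((i , e) ∷ S) p≤q (a , b , c , ok) =
    ℕP.≤-trans p≤q a , b , c , OK-antitone S (ℕP.+-monoˡ-≤ e p≤q) ok

  -- Each entry is at least the sum above it, so adding it at least doubles the running sum, which
  -- starts at p.
  OK-double : ∀ p S → OK p S → p * 2 ^ length S ≤ p + total S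
  OK-double p [] ok = ℕP.≤-reflexive (trans (ℕP.*-identityʳ p) (sym (ℕP.+-identityʳ p)))
  OK-double p ((i , e) ∷ S) (p≤e , _ , _ , ok) = ℕP.≤-trans
    (ℕP.≤-trans (ℕP.≤-reflexive (dbl p (2 ^ length S))) (ℕP.*-monoˡ-≤ (2 ^ length S) (ℕP.+-monoʳ-≤ p p≤e)))
    (ℕP.≤-trans (OK-double (p + e) S ok) (ℕP.≤-reflexive (ℕP.+-assoc p e (total S))))
    where
    dbl : ∀ p x → p * (2 * x) ≡ (p + p) * x
    dbl = solve-∀

  -- The positive degree on top starts the doubling, which leaves only the tail to be counted. The
  -- whole stack is one longer, whence the `suc` in `lg`.
  OK-length : ∀ i e S → OK 0 ((i , e) ∷ S) → 2 ^ length S ≤ total ((i , e) ∷ S)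
  OK-length i e S (_ , 1≤e , _ , ok) = ℕP.≤-trans
    (ℕP.≤-trans (ℕP.≤-reflexive (sym (ℕP.*-identityˡ _))) (ℕP.*-monoˡ-≤ (2 ^ length S) 1≤e)) (OK-double e S ok)

  After : ∀ {A} → ℕ → Entry A → Set
  After t E = OK 0 (stack E) × suc (total (stack E)) ≡ t

  mutual
    -- `OK e S` says that the waiting entries dominate the degree under expansion. Deferring the
    -- larger factor preserves this: it dominates the smaller one, and below it the sum of both is
    -- the old degree. Emitting a variable spends one unit of the total.
    expand-after : ∀ h i e S → degAt C i ≤ D → OK e S → All (After (e + total S)) (expand h i e S)
    expand-after zero i e S le ok = []
    expand-after (suc h) i e S le ok =
      expandGate-after h (gateAt C i) i e S (subst (_≤ D) (degAt-gate C i) le) ok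

    expandGate-after : ∀ h g i e S → gateDeg (degAt C) g ≤ D → OK e S → All (After (e + total S)) (expandGate h g i e S)
    expandGate-after h (input-var x) i zero S le ok = []
    expandGate-after h (input-var x) i (suc zero) S le ok = (OK-antitone S z≤n ok , refl) ∷ []
    expandGate-after h (input-var x) i (suc (suc e)) S le ok = []
    expandGate-after h (input-cst c) i e S le ok = []
    expandGate-after h (add a b) i e S le ok = AllP.++⁺
      (expand-after h a e S (ℕP.≤-trans (ℕP.m≤m⊔n _ _) le) ok)
      (expand-after h b e S (ℕP.≤-trans (ℕP.m≤n⊔m (degAt C a) _) le) ok)
    expandGate-after h (mul a b) i e S le ok = AllP.concat⁺ (AllP.map⁺ (All.map
      (λ { {x , y} refl → expandMul-after h a b x y S (ℕP.≤-trans (ℕP.m≤m+n _ _) le)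
             (ℕP.≤-trans (ℕP.m≤n+m _ (degAt C a)) le) ok }) (anti-sum e)))

    expandMul-after : ∀ h a b x y S → degAt C a ≤ D → degAt C b ≤ D → OK (x + y) S →
      All (After (x + y + total S)) (expandMul h a b x y S)
    expandMul-after h a b zero y S la lb ok = AllP.map⁺ (expand-after h b y S lb ok)
    expandMul-after h a b (suc x) zero S la lb ok rewrite ℕP.+-identityʳ x = AllP.map⁺ (expand-after h a (suc x) S la ok)
    expandMul-after h a b (suc x) (suc y) S la lb ok with x ≤? y
    ... | yes x≤y = All.map (λ { (p , q) → p , trans q (sym (ℕP.+-assoc (suc x) (suc y) (total S))) })
      (expand-after h a (suc x) ((b , suc y) ∷ S) la (s≤s x≤y , s≤s z≤n , lb , ok))
    ... | no x≰y = All.map (λ { (p , q) → p , trans q (trans (sym (ℕP.+-assoc (suc y) (suc x) (total S)))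
                                                   (cong (_+ total S) (ℕP.+-comm (suc y) (suc x)))) })
      (expand-after h b (suc y) ((a , suc x) ∷ S) lb
        (ℕP.≰⇒≥ (λ z → x≰y (s≤s⁻¹ z)) , s≤s z≤n , la , subst (λ t → OK t S) (ℕP.+-comm (suc x) (suc y)) ok))

  -- N i bounds the constant term of gate i and the weight of its expansion in any degree ≤ d. One level
  -- of the circuit contributes a factor 2 ^ (d + 1), enough for the d + 1 ways of splitting a degree.
  N : Fin s → ℕ
  N i = 2 ^ (suc d * ((s ∸ toℕ i) * degAt C i))

  N-pos : ∀ i → 1 ≤ N i
  N-pos i = ℕP.m^n>0 2 (suc d * ((s ∸ toℕ i) * degAt C i))

  private
    suc-∸ : ∀ (i : Fin s) → suc (s ∸ suc (toℕ i)) ≡ s ∸ toℕ i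
    suc-∸ i = sym (ℕP.+-∸-assoc 1 (FinP.toℕ<n i))

    height-≤ : ∀ {i j : Fin s} → toℕ i < toℕ j → s ∸ toℕ j ≤ s ∸ suc (toℕ i)
    height-≤ lt = ℕP.∸-monoʳ-≤ s lt

  -- The factor c costs one more unit next to w in the exponent. The level of i itself provides
  -- `degAt C i` units, and that is at least one.
  N-step : ∀ {i} (c w : ℕ) → c ≤ 2 ^ suc d → w ≤ (s ∸ suc (toℕ i)) * degAt C i → c * 2 ^ (suc d * w) ≤ N i
  N-step {i} c w c≤ w≤ = begin′
    where
    open ℕP.≤-Reasoning renaming (begin_ to begin≤_; _∎ to _∎≤)
    begin′ : c * 2 ^ (suc d * w) ≤ N i
    begin′ = begin≤
      c * 2 ^ (suc d * w)                     ≤⟨ ℕP.*-monoˡ-≤ _ c≤ ⟩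
      2 ^ suc d * 2 ^ (suc d * w)             ≡⟨ ℕP.^-distribˡ-+-* 2 (suc d) (suc d * w) ⟨
      2 ^ (suc d + suc d * w)                 ≡⟨ cong (2 ^_) (ℕP.*-suc (suc d) w) ⟨
      2 ^ (suc d * suc w)                     ≤⟨ ℕP.^-monoʳ-≤ 2 (ℕP.*-monoʳ-≤ (suc d)
                                                   (ℕP.+-mono-≤ (degAt-pos C i) w≤)) ⟩
      2 ^ (suc d * (suc (s ∸ suc (toℕ i)) * degAt C i)) ≡⟨ cong (λ t → 2 ^ (suc d * (t * degAt C i))) (suc-∸ i) ⟩
      N i ∎≤

  N-add : ∀ {i a b} → gateAt C i ≡ add a b → N a + N b ≤ N i
  N-add {i} {a} {b} eq = ℕP.≤-trans (ℕP.+-mono-≤ (child a (proj₁ after) (ℕP.m≤m⊔n _ _)) (child b (proj₂ after) (ℕP.m≤n⊔m (degAt C a) _)))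
    (ℕP.≤-trans (ℕP.≤-reflexive (cong (w +_) (sym (ℕP.+-identityʳ w))))
    (N-step {i} 2 ((s ∸ suc (toℕ i)) * degAt C i) (ℕP.^-monoʳ-≤ 2 {1} {suc d} (s≤s z≤n)) ℕP.≤-refl))
    where
    w = 2 ^ (suc d * ((s ∸ suc (toℕ i)) * degAt C i))
    after : toℕ i < toℕ a × toℕ i < toℕ b
    after = subst (ChildrenAfter (toℕ i)) eq (gateAt-children C i)
    child : ∀ (c : Fin s) → toℕ i < toℕ c → degAt C c ≤ degAt C a ⊔ degAt C b → N c ≤ w
    child c lt le = ℕP.^-monoʳ-≤ 2 (ℕP.*-monoʳ-≤ (suc d) (ℕP.*-mono-≤ (height-≤ lt)
      (subst (degAt C c ≤_) (sym (trans (degAt-gate C i) (cong (gateDeg (degAt C)) eq))) le)))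

  -- Exponents of a product add, and so do formal degrees at a multiplication gate; this is why
  -- `degAt` appears in the exponent of `N`. The level gained by i pays for the factor `suc d`.
  N-mul : ∀ {i a b} → gateAt C i ≡ mul a b → suc d * (N a * N b) ≤ N i
  N-mul {i} {a} {b} eq = subst (_≤ N i) (cong (suc d *_) pows)
    (N-step {i} (suc d) (ha * degAt C a + hb * degAt C b) (ℕP.≤-trans (n<2^n d) (ℕP.^-monoʳ-≤ 2 (ℕP.n≤1+n d)))
      (ℕP.≤-trans (ℕP.+-mono-≤ (ℕP.*-monoˡ-≤ (degAt C a) (height-≤ (proj₁ after))) (ℕP.*-monoˡ-≤ (degAt C b) (height-≤ (proj₂ after))))
        (ℕP.≤-reflexive (trans (sym (ℕP.*-distribˡ-+ (s ∸ suc (toℕ i)) (degAt C a) (degAt C b)))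
          (cong ((s ∸ suc (toℕ i)) *_) (sym (trans (degAt-gate C i) (cong (gateDeg (degAt C)) eq))))))))
    where
    ha = s ∸ toℕ a
    hb = s ∸ toℕ b
    after : toℕ i < toℕ a × toℕ i < toℕ b
    after = subst (ChildrenAfter (toℕ i)) eq (gateAt-children C i)
    pows : 2 ^ (suc d * (ha * degAt C a + hb * degAt C b)) ≡ N a * N b
    pows = trans (cong (2 ^_) (ℕP.*-distribˡ-+ (suc d) (ha * degAt C a) (hb * degAt C b)))
      (ℕP.^-distribˡ-+-* 2 (suc d * (ha * degAt C a)) (suc d * (hb * degAt C b)))

  ∣c₀∣≤N : ∀ i → ∣ c₀ i ∣ ≤ N i
  ∣c₀∣≤N = gate-induction _ λ i ih → subst (λ f → ∣ f (replicate k 0) ∣ ≤ N i) (sym (valAt-gate C i))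
    (by i ih (gateAt C i) refl (gateAt-children C i))
    where
    by : ∀ i → (∀ j → toℕ i < toℕ j → ∣ c₀ j ∣ ≤ N j) → ∀ g → gateAt C i ≡ g → ChildrenAfter (toℕ i) g →
         ∣ gateVal (valAt C) g (replicate k 0) ∣ ≤ N i
    by i ih (input-var x) eq _ = subst (λ z → ∣ z ∣ ≤ N i)
      (sym (varP-supp x (replicate k 0) (λ e → ℕP.0≢1+n (trans (sym (∣0∣ₘ k)) e)))) z≤n
    by i ih (input-cst c) eq _ = subst (λ z → ∣ z ∣ ≤ N i) (sym (constP-at {k} (constVal c)))
      (ℕP.≤-trans (unit c) (N-pos i))
      where
      unit : ∀ c → ∣ constVal c ∣ ≤ 1
      unit c-1 = s≤s z≤n
      unit c0 = z≤n
      unit c1 = s≤s z≤n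
    by i ih (add a b) eq (p , q) = ℕP.≤-trans (ℤP.∣i+j∣≤∣i∣+∣j∣ (c₀ a) (c₀ b))
      (ℕP.≤-trans (ℕP.+-mono-≤ (ih a p) (ih b q)) (N-add eq))
    by i ih (mul a b) eq (p , q) = subst (λ z → ∣ z ∣ ≤ N i) (sym (*P-at-0 (valAt C a) (valAt C b)))
      (subst (_≤ N i) (sym (ℤP.abs-* (c₀ a) (c₀ b)))
      (ℕP.≤-trans (ℕP.*-mono-≤ (ih a p) (ih b q)) (ℕP.≤-trans (ℕP.m≤n*m (N a * N b) (suc d)) (N-mul eq))))

  -- A potential for what the stack may still produce. If an entry counts as its coefficient times
  -- the potential of its remaining stack, one expansion never increases the total, and this
  -- iterates over any number of steps.
  Φ : Stack → ℕ
  Φ [] = 1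
  Φ ((i , _) ∷ S) = N i * Φ S

  Φ-pos : ∀ S → 1 ≤ Φ S
  Φ-pos [] = s≤s z≤n
  Φ-pos ((i , _) ∷ S) = ℕP.*-mono-≤ (N-pos i) (Φ-pos S)

  weight : ∀ {A} → Entry A → ℕ
  weight t = ∣ proj₁ t ∣ * Φ (stack t)

  weights : ∀ {A} → List (Entry A) → ℕ
  weights E = sum (map weight E)

  weights-++ : ∀ {A} (E F : List (Entry A)) → weights (E ++ F) ≡ weights E + weights F
  weights-++ E F = trans (cong sum (ListP.map-++ weight E F)) (sum-++ (map weight E) (map weight F))

  weights-scale : ∀ {A} c (E : List (Entry A)) → weights (scale c E) ≡ ∣ c ∣ * weights E
  weights-scale c E = trans (cong sum (trans (sym (ListP.map-∘ E)) (ListP.map-cong (λ t →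
    trans (cong (_* Φ (stack t)) (ℤP.abs-* c (proj₁ t))) (ℕP.*-assoc ∣ c ∣ ∣ proj₁ t ∣ (Φ (stack t)))) E)))
    (sum-map-* ∣ c ∣ weight E)

  mutual
    expand-weights : ∀ h i e S → e ≤ d → weights (expand h i e S) ≤ N i * Φ S
    expand-weights zero i e S le = z≤n
    expand-weights (suc h) i e S le = expandGate-weights h (gateAt C i) i e S le refl

    expandGate-weights : ∀ h g i e S → e ≤ d → gateAt C i ≡ g → weights (expandGate h g i e S) ≤ N i * Φ S
    expandGate-weights h (input-var x) i zero S le eq = z≤n
    expandGate-weights h (input-var x) i (suc zero) S le eq =
      ℕP.≤-trans (ℕP.≤-reflexive (ℕP.+-identityʳ _)) (ℕP.*-monoˡ-≤ (Φ S) (N-pos i))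
    expandGate-weights h (input-var x) i (suc (suc e)) S le eq = z≤n
    expandGate-weights h (input-cst c) i e S le eq = z≤n
    expandGate-weights h (add a b) i e S le eq = ℕP.≤-trans (ℕP.≤-reflexive (weights-++ (expand h a e S) _))
      (ℕP.≤-trans (ℕP.+-mono-≤ (expand-weights h a e S le) (expand-weights h b e S le))
      (ℕP.≤-trans (ℕP.≤-reflexive (sym (ℕP.*-distribʳ-+ (Φ S) (N a) (N b)))) (ℕP.*-monoˡ-≤ (Φ S) (N-add eq))))
    -- There are `suc e` ways to split the degree, at most `suc d` of them, each of weight at most
    -- `N a * N b * Φ S`; `N-mul` absorbs their number.
    expandGate-weights h (mul a b) i e S le eq = ℕP.≤-trans
      (sum-concatMap-≤ weight _ (λ _ → N a * N b * Φ S) (All.map (λ { {x , y} refl → expandMul-weights h a b x y S le }) (anti-sum e)))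
      (ℕP.≤-trans (ℕP.≤-reflexive (trans (sum-map-const _ (anti e)) (trans (cong (_* (N a * N b * Φ S)) (length-anti e)) (sym (ℕP.*-assoc (suc e) (N a * N b) (Φ S))))))
      (ℕP.*-monoˡ-≤ (Φ S) (ℕP.≤-trans (ℕP.*-monoˡ-≤ (N a * N b) (s≤s le)) (N-mul eq))))

    expandMul-weights : ∀ h a b x y S → x + y ≤ d → weights (expandMul h a b x y S) ≤ N a * N b * Φ S
    expandMul-weights h a b zero y S le = ℕP.≤-trans (ℕP.≤-reflexive (weights-scale (c₀ a) (expand h b y S)))
      (ℕP.≤-trans (ℕP.*-mono-≤ (∣c₀∣≤N a) (expand-weights h b y S le)) (ℕP.≤-reflexive (sym (ℕP.*-assoc (N a) (N b) (Φ S)))))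
    expandMul-weights h a b (suc x) zero S le = ℕP.≤-trans (ℕP.≤-reflexive (weights-scale (c₀ b) (expand h a (suc x) S)))
      (ℕP.≤-trans (ℕP.*-mono-≤ (∣c₀∣≤N b) (expand-weights h a (suc x) S (ℕP.≤-trans (ℕP.m≤m+n _ 0) le)))
        (ℕP.≤-reflexive (swap (N b) (N a) (Φ S))))
      where
      swap : ∀ x y z → x * (y * z) ≡ y * x * z
      swap = solve-∀
    expandMul-weights h a b (suc x) (suc y) S le with x ≤? y
    ... | yes _ = ℕP.≤-trans (expand-weights h a (suc x) _ (ℕP.≤-trans (ℕP.m≤m+n _ (suc y)) le))
      (ℕP.≤-reflexive (sym (ℕP.*-assoc (N a) (N b) (Φ S))))
    ... | no  _ = ℕP.≤-trans (expand-weights h b (suc y) _ (ℕP.≤-trans (ℕP.m≤n+m _ (suc x)) le))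
      (ℕP.≤-reflexive (swap (N b) (N a) (Φ S)))
      where
      swap : ∀ x y z → x * (y * z) ≡ y * x * z
      swap = solve-∀

-- Merging entries with equal keys

module Collect {K : Set} (_≟_ : DecidableEquality K) where

  pick : K → ℤ × K → ℤ
  pick κ (z , κ′) with κ′ ≟ κ
  ... | yes _ = z
  ... | no  _ = 0ℤ

  coef : List (ℤ × K) → K → ℤ
  coef E κ = ∑ E (pick κ)

  pick-≡ : ∀ z κ → pick κ (z , κ) ≡ z
  pick-≡ z κ with κ ≟ κ
  ... | yes _ = refl
  ... | no ne = ⊥-elim (ne refl)

  pick-≢ : ∀ z κ κ′ → κ′ ≢ κ → pick κ (z , κ′) ≡ 0ℤ
  pick-≢ z κ κ′ ne with κ′ ≟ κ
  ... | yes e = ⊥-elim (ne e)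
  ... | no _ = refl

  ∣pick∣≤ : ∀ κ t → ∣ pick κ t ∣ ≤ ∣ proj₁ t ∣
  ∣pick∣≤ κ (z , κ′) with κ′ ≟ κ
  ... | yes _ = ℕP.≤-refl
  ... | no  _ = z≤n

  ∣coef∣≤ : ∀ E κ → ∣ coef E κ ∣ ≤ sum (map (λ t → ∣ proj₁ t ∣) E)
  ∣coef∣≤ [] κ = z≤n
  ∣coef∣≤ (t ∷ E) κ = ℕP.≤-trans (ℤP.∣i+j∣≤∣i∣+∣j∣ (pick κ t) (coef E κ)) (ℕP.+-mono-≤ (∣pick∣≤ κ t) (∣coef∣≤ E κ))

  -- By induction on E: a further entry changes only the coefficient at its own key, and `∑-delta`
  -- isolates that summand.
  collect : ∀ {k} (v : K → Poly k) (𝒦 : List K) → Unique 𝒦 → ∀ E → All (λ t → proj₂ t ∈ 𝒦) E →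
    ∑ᴾ E (λ t → cst (proj₁ t) ⊠ v (proj₂ t)) ≋ ∑ᴾ 𝒦 (λ κ → cst (coef E κ) ⊠ v κ)
  collect v 𝒦 u [] [] = PR.sym (PΣ.∑-zero 𝒦 (λ κ → PR.zeroˡ (v κ)))
  collect v 𝒦 u ((z , κ₀) ∷ E) (κ₀∈ ∷ ∈s) = PR.sym (begin
    ∑ᴾ 𝒦 (λ κ → cst (pick κ (z , κ₀) +ᶻ coef E κ) ⊠ v κ)
      ≈⟨ PΣ.∑-cong 𝒦 (λ κ → PR.trans (PR.*-congʳ (cst-+ _ _)) (PR.distribʳ _ _ _)) ⟩
    ∑ᴾ 𝒦 (λ κ → cst (pick κ (z , κ₀)) ⊠ v κ ⊞ cst (coef E κ) ⊠ v κ)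
      ≈⟨ PΣ.∑-⊕ 𝒦 _ _ ⟩
    ∑ᴾ 𝒦 (λ κ → cst (pick κ (z , κ₀)) ⊠ v κ) ⊞ ∑ᴾ 𝒦 (λ κ → cst (coef E κ) ⊠ v κ)
      ≈⟨ PR.+-cong (PR.trans
           (PΣ.∑-delta u κ₀∈ (λ κ ne → PR.trans
             (PR.*-congʳ (PR.reflexive (cong cst (pick-≢ z κ κ₀ (λ e → ne (sym e)))))) (PR.zeroˡ _)))
           (PR.*-congʳ (PR.reflexive (cong cst (pick-≡ z κ₀)))))
         (PR.sym (collect v 𝒦 u E ∈s)) ⟩
    cst z ⊠ v κ₀ ⊞ ∑ᴾ E (λ t → cst (proj₁ t) ⊠ v (proj₂ t)) ∎)
    where open import Relation.Binary.Reasoning.Setoid PR.setoid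

length-cartesianProductWith : ∀ {A B C : Set} (f : A → B → C) xs ys →
  length (cartesianProductWith f xs ys) ≡ length xs * length ys
length-cartesianProductWith f [] ys = refl
length-cartesianProductWith f (x ∷ xs) ys = trans (ListP.length-++ (map (f x) ys))
  (cong₂ _+_ (ListP.length-map (f x) ys) (length-cartesianProductWith f xs ys))

module _ {A : Set} where

  -- Shorter words are included because runs may end early and stacks vary in length. Stopping acts
  -- like one extra letter, hence the base `suc (length L)` in the count.
  words : List A → ℕ → List (List A)
  words L zero = [] ∷ []
  words L (suc n) = [] ∷ cartesianProductWith _∷_ L (words L n)

  length-words : ∀ L n → length (words L n) ≤ suc (length L) ^ n
  length-words L zero = s≤s z≤n
  length-words L (suc n) = ℕP.+-mono-≤ (ℕP.m^n>0 (suc (length L)) n)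
    (ℕP.≤-trans (ℕP.≤-reflexive (length-cartesianProductWith _∷_ L (words L n)))
      (ℕP.*-monoʳ-≤ (length L) (length-words L n)))

  words-∈ : ∀ L n w → length w ≤ n → All (_∈ L) w → w ∈ words L n
  words-∈ L zero [] _ _ = here refl
  words-∈ L (suc n) [] _ _ = here refl
  words-∈ L (suc n) (x ∷ w) (s≤s le) (x∈ ∷ w∈) = there (∈P.∈-cartesianProductWith⁺ _∷_ x∈ (words-∈ L n w le w∈))

  words-unique : ∀ {L} → Unique L → ∀ n → Unique (words L n)
  words-unique u zero = [] ∷ []
  words-unique {L} u (suc n) = AllP.cartesianProductWith⁺ (≡.setoid A) (≡.setoid (List A)) _∷_ L (words L n) (λ _ _ ())
    ∷ Uniq.cartesianProductWith⁺ _∷_ ListP.∷-injective u (words-unique u n)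

-- Runs, blocks and paths

module Run {k s} (C : Circuit k s) (D d r : ℕ) where

  open Machine C D d

  -- Letters are gates rather than variables: the number of variables is not bounded by the circuit
  -- size, whereas that of gates is.
  Word : Set
  Word = List (Fin s)

  word : Word → Poly k
  word = foldr (λ x → letter x ⊠_) (cst 1ℤ)

  prepend : ℤ → Fin s → Entry Word → Entry Word
  prepend z x (z′ , w , S) = z *ᶻ z′ , x ∷ w , S

  -- A run is cut after a emissions, or earlier if the stack is empty; in the first case the rest of
  -- the work stays on the stack.
  run : ℕ → Stack → List (Entry Word)
  run zero S = (1ℤ , [] , S) ∷ []
  run (suc a) [] = (1ℤ , [] , []) ∷ []
  run (suc a) ((i , e) ∷ S) =
    concatMap (λ t → map (prepend (proj₁ t) (proj₁ (proj₂ t))) (run a (stack t))) (expand s i e S)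

  module L = Value letter
  module V = Value word

  open import Relation.Binary.Reasoning.Setoid (PR.setoid {k}) using (begin_; step-≈-⟩; step-≈-⟨; _∎)
  open import Algebra.Properties.CommutativeSemigroup (PR.*-commutativeSemigroup {k}) using (x∙yz≈y∙xz)

  private
    stop : ∀ S → V.⟪ (1ℤ , [] , S) ∷ [] ⟫ ≋ ⟦ S ⟧
    stop S = PR.trans (PR.+-identityʳ _) (PR.trans (PR.*-identityˡ _) (PR.*-identityˡ _))

  prepend-value : ∀ z x E → V.⟪ map (prepend z x) E ⟫ ≋ cst z ⊠ (letter x ⊠ V.⟪ E ⟫)
  prepend-value z x E = begin
    V.⟪ map (prepend z x) E ⟫
      ≈⟨ PΣ.∑-map (prepend z x) E V.term ⟩
    ∑ᴾ E (λ t → V.term (prepend z x t))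
      ≈⟨ PΣ.∑-cong E (λ t → rearrange (cst-* z (proj₁ t))) ⟩
    ∑ᴾ E (λ t → cst z ⊠ (letter x ⊠ V.term t))
      ≈⟨ PΣ.∑-⊗ˡ (cst z) E (λ t → letter x ⊠ V.term t) ⟨
    cst z ⊠ ∑ᴾ E (λ t → letter x ⊠ V.term t)
      ≈⟨ PR.*-congˡ (PΣ.∑-⊗ˡ (letter x) E V.term) ⟨
    cst z ⊠ (letter x ⊠ V.⟪ E ⟫) ∎
    where
    rearrange : ∀ {c a b l w v : Poly k} → c ≋ a ⊠ b → c ⊠ ((l ⊠ w) ⊠ v) ≋ a ⊠ (l ⊠ (b ⊠ (w ⊠ v)))
    rearrange {c} {a} {b} {l} {w} {v} e = begin
      c ⊠ ((l ⊠ w) ⊠ v)          ≈⟨ PR.*-cong e (PR.*-assoc l w v) ⟩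
      (a ⊠ b) ⊠ (l ⊠ (w ⊠ v))    ≈⟨ PR.*-assoc a b _ ⟩
      a ⊠ (b ⊠ (l ⊠ (w ⊠ v)))    ≈⟨ PR.*-congˡ (x∙yz≈y∙xz b l (w ⊠ v)) ⟩
      a ⊠ (l ⊠ (b ⊠ (w ⊠ v)))    ∎

  private
    fuel : ∀ (i : Fin s) → s ≤ s + toℕ i
    fuel i = ℕP.m≤m+n s (toℕ i)

  run-sound : ∀ a S → OK 0 S → V.⟪ run a S ⟫ ≋ ⟦ S ⟧
  run-sound zero S ok = stop S
  run-sound (suc a) [] ok = stop []
  run-sound (suc a) ((i , suc e) ∷ S) (_ , _ , le , ok) = begin
    V.⟪ run (suc a) ((i , suc e) ∷ S) ⟫
      ≈⟨ PΣ.∑-concatMap (λ t → map (prepend (proj₁ t) (proj₁ (proj₂ t))) (run a (stack t))) (expand s i (suc e) S) V.term ⟩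
    ∑ᴾ (expand s i (suc e) S) (λ t → V.⟪ map (prepend (proj₁ t) (proj₁ (proj₂ t))) (run a (stack t)) ⟫)
      ≈⟨ PΣ.∑-congᴬ (All.map (λ {t} p → PR.trans (prepend-value (proj₁ t) (proj₁ (proj₂ t)) (run a (stack t)))
           (PR.*-congˡ (PR.*-congˡ (run-sound a (stack t) (proj₁ p))))) (expand-after s i (suc e) S le ok)) ⟩
    L.⟪ expand s i (suc e) S ⟫
      ≈⟨ expand-sound s i e S (fuel i) ⟩
    part i (suc e) ⊠ ⟦ S ⟧ ∎

  -- Truncated subtraction covers both ways of ending: a units have been spent, or the stack has
  -- been emptied before.
  Ran : ℕ → ℕ → Entry Word → Set
  Ran a t E = length (proj₁ (proj₂ E)) ≤ a × OK 0 (stack E) × total (stack E) ≤ t ∸ a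

  run-after : ∀ a S → OK 0 S → All (Ran a (total S)) (run a S)
  run-after zero S ok = (z≤n , ok , ℕP.≤-refl) ∷ []
  run-after (suc a) [] ok = (z≤n , ok , z≤n) ∷ []
  run-after (suc a) ((i , e) ∷ S) (_ , _ , le , ok) = AllP.concat⁺ (AllP.map⁺ (All.map
    (λ {t} p → AllP.map⁺ (All.map (λ { {E} (q₁ , q₂ , q₃) →
        s≤s q₁ , q₂ , subst (λ x → total (stack E) ≤ x ∸ suc a) (proj₂ p) q₃ }) (run-after a (stack t) (proj₁ p))))
    (expand-after s i e S le ok)))

  weights-prepend : ∀ z x E → weights (map (prepend z x) E) ≡ ∣ z ∣ * weights E
  weights-prepend z x E = trans (cong sum (trans (sym (ListP.map-∘ E)) (ListP.map-cong (λ t →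
    trans (cong (_* Φ (stack t)) (ℤP.abs-* z (proj₁ t))) (ℕP.*-assoc ∣ z ∣ ∣ proj₁ t ∣ (Φ (stack t)))) E)))
    (sum-map-* ∣ z ∣ weight E)

  run-weights : ∀ a S → OK 0 S → total S ≤ d → weights (run a S) ≤ Φ S
  run-weights zero S ok le = ℕP.≤-reflexive (trans (ℕP.+-identityʳ _) (ℕP.*-identityˡ _))
  run-weights (suc a) [] ok le = ℕP.≤-refl
  run-weights (suc a) ((i , e) ∷ S) (_ , _ , le , ok) tot = ℕP.≤-trans
    (sum-concatMap-≤ weight (λ t → map (prepend (proj₁ t) (proj₁ (proj₂ t))) (run a (stack t))) weight
      (All.map (λ {t} p → ℕP.≤-trans (ℕP.≤-reflexive (weights-prepend (proj₁ t) (proj₁ (proj₂ t)) (run a (stack t))))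
        (ℕP.*-monoʳ-≤ ∣ proj₁ t ∣ (run-weights a (stack t) (proj₁ p)
          (ℕP.≤-trans (ℕP.n≤1+n _) (ℕP.≤-trans (ℕP.≤-reflexive (proj₂ p)) tot)))))
      (expand-after s i e S le ok)))
    (expand-weights s i e S (ℕP.≤-trans (ℕP.m≤m+n e (total S)) tot))

  module Blocks (o : Fin s) (o≤D : degAt C o ≤ D) (vanish : VanishesAbove d (valAt C o)) where

    -- The output need not be homogeneous, so the first block starts in all degrees at once: the
    -- constant term, and a one-entry stack for each degree from 1 to d.
    start : List (Entry Word)
    start = (c₀ o , [] , []) ∷ concatMap (λ e → run r ((o , suc e) ∷ [])) (upTo d)

    private
      ok₁ : ∀ e → OK 0 ((o , suc e) ∷ [])
      ok₁ e = z≤n , s≤s z≤n , o≤D , tt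

    start-sound : V.⟪ start ⟫ ≋ valAt C o
    start-sound = begin
      V.⟪ start ⟫
        ≈⟨ PR.+-cong (PR.trans (PR.*-congˡ (PR.*-identityˡ _)) (PR.trans (PR.*-identityʳ _) (PR.sym (H-0 (valAt C o)))))
             (PΣ.∑-concatMap (λ e → run r ((o , suc e) ∷ [])) (upTo d) V.term) ⟩
      part o 0 ⊞ ∑ᴾ (upTo d) (λ e → V.⟪ run r ((o , suc e) ∷ []) ⟫)
        ≈⟨ PR.+-congˡ (PΣ.∑-cong (upTo d) (λ e → PR.trans (run-sound r _ (ok₁ e)) (PR.*-identityʳ _))) ⟩
      part o 0 ⊞ ∑ᴾ (upTo d) (λ e → part o (suc e))
        ≈⟨ PΣ.∑-upTo-suc d (part o) ⟨
      ∑ᴾ (upTo (suc d)) (part o)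
        ≈⟨ ∑-H d (valAt C o) vanish ⟨
      valAt C o ∎

    start-after : All (Ran r d) start
    start-after = (z≤n , tt , z≤n) ∷ AllP.concat⁺ (AllP.map⁺ (AllP.applyUpTo⁺₁ (λ e → e) d (λ {e} e<d →
      All.map (λ { (p , q , t) → p , q , ℕP.≤-trans t (ℕP.∸-monoˡ-≤ r
        (ℕP.≤-trans (ℕP.≤-reflexive (cong suc (ℕP.+-identityʳ e))) e<d)) }) (run-after r _ (ok₁ e)))))

    start-weights : weights start ≤ suc d * N o
    start-weights = ℕP.+-mono-≤ (ℕP.≤-trans (ℕP.≤-reflexive (ℕP.*-identityʳ _)) (∣c₀∣≤N o))
      (ℕP.≤-trans (sum-concatMap-≤ weight (λ e → run r ((o , suc e) ∷ [])) (λ _ → N o)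
        (AllP.applyUpTo⁺₁ (λ e → e) d (λ {e} e<d → ℕP.≤-trans
          (run-weights r _ (ok₁ e) (ℕP.≤-trans (ℕP.≤-reflexive (cong suc (ℕP.+-identityʳ e))) e<d))
          (ℕP.≤-reflexive (ℕP.*-identityʳ (N o))))))
      (ℕP.≤-reflexive (trans (sum-map-const (N o) (upTo d)) (cong (_* N o) (ListP.length-upTo d)))))

    -- `nothing` marks the beginning, where the runs of all degrees are merged; every later block
    -- begins in a definite stack.
    State : Set
    State = Maybe Stack

    entries : State → List (Entry Word)
    entries nothing = start
    entries (just S) = run r S

    _≟ʷ_ : DecidableEquality (Word × Stack)
    _≟ʷ_ = ×P.≡-dec (ListP.≡-dec Fin._≟_) (ListP.≡-dec (×P.≡-dec Fin._≟_ ℕP._≟_))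

    open Collect _≟ʷ_

    𝒲 : List Word
    𝒲 = words (allFin s) r

    items : List Item
    items = cartesianProduct (allFin s) (upTo (suc d))

    Legal : Stack → Set
    Legal S = OK 0 S × total S ≤ d

    legal? : ∀ S → Dec (Legal S)
    legal? S = OK? 0 S ×-dec (total S ≤? d)

    𝒮 : List Stack
    𝒮 = filter legal? (words items (lg d))

    length-legal : ∀ S → Legal S → length S ≤ lg d
    length-legal [] _ = z≤n
    length-legal ((i , e) ∷ S) (ok , le) = s≤s (ℕP.≤-trans (ℕP.≤-reflexive (sym (⌊log₂[2^n]⌋≡n (length S))))
      (⌊log₂⌋-mono-≤ (ℕP.≤-trans (OK-length i e S ok) le)))

    𝒮-∈ : ∀ S → Legal S → S ∈ 𝒮
    𝒮-∈ S l = ∈P.∈-filter⁺ legal? (words-∈ items (lg d) S (length-legal S l) (inItems S (proj₂ l))) l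
      where
      inItems : ∀ S → total S ≤ d → All (_∈ items) S
      inItems [] _ = []
      inItems ((i , e) ∷ S) le =
        ∈P.∈-cartesianProduct⁺ (∈P.∈-allFin i) (∈P.∈-upTo⁺ (s≤s (ℕP.≤-trans (ℕP.m≤m+n e _) le)))
        ∷ inItems S (ℕP.≤-trans (ℕP.m≤n+m _ e) le)

    𝒲-∈ : ∀ w → length w ≤ r → w ∈ 𝒲
    𝒲-∈ w le = words-∈ (allFin s) r w le (All.universal ∈P.∈-allFin w)

    Label : Set
    Label = State × Stack

    coefficient : Label → Word → ℤ
    coefficient (a , S) w = coef (entries a) (w , S)

    blockVal : Label → Poly k
    blockVal l = ∑ᴾ 𝒲 (λ w → cst (coefficient l w) ⊠ word w)

    within? : ∀ j S → Dec (total S ≤ j * r)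
    within? j S = total S ≤? j * r

    -- With j blocks left, only a total of at most j * r can still be emitted. For j = 0 this forces
    -- the empty stack, because degrees are positive, so every path ends with the work done.
    targets : ℕ → List Stack
    targets j = filter (within? j) 𝒮

    paths : ∀ j → State → List (Vec Label j)
    paths zero a = [] ∷ []
    paths (suc j) a = concatMap (λ S → map ((a , S) ∷_) (paths j (just S))) (targets j)

    pathVal : ∀ {j} → Vec Label j → Poly k
    pathVal [] = cst 1ℤ
    pathVal (l ∷ p) = blockVal l ⊠ pathVal p

    Target : ℕ → Entry Word → Set
    Target j t = proj₁ (proj₂ t) ∈ 𝒲 × stack t ∈ targets j

    -- Grouping by word and final stack lets `⟦ S ⟧` be factored out. What remains depends on a and
    -- S alone, so the same block serves at every position of a path.
    entries-value : ∀ j a → All (Target j) (entries a) →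
      V.⟪ entries a ⟫ ≋ ∑ᴾ (targets j) (λ S → blockVal (a , S) ⊠ ⟦ S ⟧)
    entries-value j a ts = begin
      V.⟪ entries a ⟫
        ≈⟨ collect (λ κ → word (proj₁ κ) ⊠ ⟦ proj₂ κ ⟧) (cartesianProduct 𝒲 (targets j))
             (Uniq.cartesianProduct⁺ (words-unique (Uniq.allFin⁺ s) r) (Uniq.filter⁺ (within? j) (Uniq.filter⁺ legal?
               (words-unique (Uniq.cartesianProduct⁺ (Uniq.allFin⁺ s) (Uniq.upTo⁺ (suc d))) (lg d)))))
             (entries a) (All.map (λ { (p , q) → ∈P.∈-cartesianProduct⁺ p q }) ts) ⟩
      ∑₂ᴾ (cartesianProduct 𝒲 (targets j)) (λ w S → cst (coefficient (a , S) w) ⊠ (word w ⊠ ⟦ S ⟧))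
        ≈⟨ PΣ.∑-cartesianProduct 𝒲 (targets j) (λ w S → cst (coefficient (a , S) w) ⊠ (word w ⊠ ⟦ S ⟧)) ⟩
      ∑ᴾ 𝒲 (λ w → ∑ᴾ (targets j) (λ S → cst (coefficient (a , S) w) ⊠ (word w ⊠ ⟦ S ⟧)))
        ≈⟨ PΣ.∑-swap 𝒲 (targets j) (λ w S → cst (coefficient (a , S) w) ⊠ (word w ⊠ ⟦ S ⟧)) ⟩
      ∑ᴾ (targets j) (λ S → ∑ᴾ 𝒲 (λ w → cst (coefficient (a , S) w) ⊠ (word w ⊠ ⟦ S ⟧)))
        ≈⟨ PΣ.∑-cong (targets j) (λ S → PR.trans
             (PΣ.∑-cong 𝒲 (λ w → PR.sym (PR.*-assoc _ _ _)))
             (PR.sym (PΣ.∑-⊗ʳ ⟦ S ⟧ 𝒲 (λ w → cst (coefficient (a , S) w) ⊠ word w)))) ⟩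
      ∑ᴾ (targets j) (λ S → blockVal (a , S) ⊠ ⟦ S ⟧) ∎

    paths-step : ∀ j a → All (Target j) (entries a) →
      (∀ S → S ∈ targets j → ∑ᴾ (paths j (just S)) pathVal ≋ ⟦ S ⟧) →
      ∑ᴾ (paths (suc j) a) pathVal ≋ V.⟪ entries a ⟫
    paths-step j a ts ih = begin
      ∑ᴾ (paths (suc j) a) pathVal
        ≈⟨ PΣ.∑-concatMap (λ S → map ((a , S) ∷_) (paths j (just S))) (targets j) pathVal ⟩
      ∑ᴾ (targets j) (λ S → ∑ᴾ (map ((a , S) ∷_) (paths j (just S))) pathVal)
        ≈⟨ PΣ.∑-congᴬ (All.tabulate (λ {S} S∈ → PR.trans (PΣ.∑-map ((a , S) ∷_) (paths j (just S)) pathVal)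
             (PR.trans (PR.sym (PΣ.∑-⊗ˡ (blockVal (a , S)) (paths j (just S)) pathVal)) (PR.*-congˡ (ih S S∈))))) ⟩
      ∑ᴾ (targets j) (λ S → blockVal (a , S) ⊠ ⟦ S ⟧)
        ≈⟨ entries-value j a ts ⟨
      V.⟪ entries a ⟫ ∎

    ran-target : ∀ j {t} → t ≤ d → t ≤ suc j * r → ∀ {E} → Ran r t E → Target j E
    ran-target j {t} t≤d t≤ {E} (p , q , le) = 𝒲-∈ _ p ,
      ∈P.∈-filter⁺ (within? j) (𝒮-∈ _ (q , ℕP.≤-trans le (ℕP.≤-trans (ℕP.m∸n≤m t r) t≤d)))
        (ℕP.≤-trans le (ℕP.≤-trans (ℕP.∸-monoˡ-≤ r t≤) (ℕP.≤-reflexive (ℕP.m+n∸m≡n r (j * r)))))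

    paths-sound : ∀ j S → Legal S → total S ≤ j * r → ∑ᴾ (paths j (just S)) pathVal ≋ ⟦ S ⟧
    paths-sound zero [] l le = PR.+-identityʳ _
    paths-sound zero ((i , zero) ∷ S) ((_ , () , _) , _) le
    paths-sound (suc j) S (ok , S≤d) le = PR.trans
      (paths-step j (just S) (All.map (λ {E} → ran-target j S≤d le {E}) (run-after r S ok))
        (λ S′ S′∈ → let S′∈𝒮 , S′≤ = ∈P.∈-filter⁻ (within? j) {xs = 𝒮} S′∈ in
          paths-sound j S′ (proj₂ (∈P.∈-filter⁻ legal? {xs = words items (lg d)} S′∈𝒮)) S′≤))
      (run-sound r S ok)

    start-paths-sound : ∀ j → d ≤ suc j * r → ∑ᴾ (paths (suc j) nothing) pathVal ≋ valAt C o
    start-paths-sound j le = PR.trans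
      (paths-step j nothing (All.map (λ {E} → ran-target j ℕP.≤-refl le {E}) start-after)
        (λ S′ S′∈ → let S′∈𝒮 , S′≤ = ∈P.∈-filter⁻ (within? j) {xs = 𝒮} S′∈ in
          paths-sound j S′ (proj₂ (∈P.∈-filter⁻ legal? {xs = words items (lg d)} S′∈𝒮)) S′≤))
      start-sound

-- Depth-four circuits

∑ᶠ ∏ᶠ : ∀ {k n} → (Fin n → Poly k) → Poly k
∑ᶠ f = foldr _⊞_ (cst 0ℤ) (tabulate f)
∏ᶠ f = foldr _⊠_ (cst 1ℤ) (tabulate f)

∑ᶠ-cong : ∀ {k n} {f g : Fin n → Poly k} → (∀ i → f i ≋ g i) → ∑ᶠ f ≋ ∑ᶠ g
∑ᶠ-cong {n = zero} e = ≋-refl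
∑ᶠ-cong {n = suc n} e = PR.+-cong (e zero) (∑ᶠ-cong (λ i → e (suc i)))

∏ᶠ-cong : ∀ {k n} {f g : Fin n → Poly k} → (∀ i → f i ≋ g i) → ∏ᶠ f ≋ ∏ᶠ g
∏ᶠ-cong {n = zero} e = ≋-refl
∏ᶠ-cong {n = suc n} e = PR.*-cong (e zero) (∏ᶠ-cong (λ i → e (suc i)))

∑ᶠ-lookup : ∀ {k} {A : Set} (xs : List A) (f : A → Poly k) → ∑ᶠ (λ i → f (List.lookup xs i)) ≋ ∑ᴾ xs f
∑ᶠ-lookup [] f = ≋-refl
∑ᶠ-lookup (x ∷ xs) f = PR.+-congˡ (∑ᶠ-lookup xs f)

opaque
  unfolding _⊞_

  sumP-tabulate : ∀ {k n} {A : Set} (F : A → Poly k) (h : Fin n → A) → sumP (map F (tabulate h)) ≋ ∑ᶠ (F ∘ h)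
  sumP-tabulate F h = PR.reflexive (cong sumP (ListP.map-tabulate h F))

  prodP-tabulate : ∀ {k n} {A : Set} (F : A → Poly k) (h : Fin n → A) → prodP (map F (tabulate h)) ≋ ∏ᶠ (F ∘ h)
  prodP-tabulate F h = PR.reflexive (cong prodP (ListP.map-tabulate h F))

tabulate-+ : ∀ {A : Set} m {n} (f : Fin (m + n) → A) → tabulate f ≡ tabulate (λ i → f (i ↑ˡ n)) ++ tabulate (λ i → f (m ↑ʳ i))
tabulate-+ zero f = refl
tabulate-+ (suc m) f = cong (f zero ∷_) (tabulate-+ m (f ∘ suc))

concat-tabulate-combine : ∀ {A : Set} n {w} (f : Fin (n * w) → A) →
  concat (tabulate {n = n} (λ i → tabulate (λ j → f (combine i j)))) ≡ tabulate f
concat-tabulate-combine zero f = refl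
concat-tabulate-combine (suc n) {w} f = trans
  (cong (tabulate (λ j → f (j ↑ˡ n * w)) ++_) (concat-tabulate-combine n (λ x → f (w ↑ʳ x))))
  (sym (tabulate-+ w f))

concatMap-combine : ∀ n w → concatMap (λ i → tabulate {n = w} (combine i)) (allFin n) ↭ allFin (n * w)
concatMap-combine n w = ↭-reflexive (trans (cong concat (ListP.map-tabulate {n = n} id (λ i → tabulate {n = w} (combine i))))
  (concat-tabulate-combine n id))

leafVal-inp : ∀ {k} (Γ : Depth4 k) i → Depth4.leafVal Γ i ≋ leafPoly (Depth4.inp Γ i)
leafVal-inp Γ i with Depth4.inp Γ i
... | var x = ≋-refl
... | num z = constP≋cst z

-- A depth-four circuit all of whose multiplication gates have fan-in R. The two bottom layers are
-- trees, so it is a formula as soon as sel enumerates the M addition gates.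
module Build {k : ℕ} (T M W R : ℕ) (sel : Fin T → Fin R → Fin M) (leaf : Fin M → Fin W → Fin R → Leaf k) where

  Γ : Depth4 k
  Γ = record
    { nIn = M * W * R ; nMul₁ = M * W ; nAdd₂ = M ; nMul₃ = T
    ; inp = λ i → uncurry (λ j x → uncurry (λ m w → leaf m w x) (remQuot {M} W j)) (remQuot {M * W} R i)
    ; mul₁ = λ j → tabulate (combine j)
    ; add₂ = λ m → tabulate (combine m)
    ; mul₃ = λ t → tabulate (sel t)
    ; out = allFin T }

  open Depth4 Γ

  block : Fin M → Poly k
  block m = ∑ᶠ (λ w → ∏ᶠ (λ x → leafPoly (leaf m w x)))

  inp-combine : ∀ m w x → inp (combine (combine m w) x) ≡ leaf m w x
  inp-combine m w x = trans
    (cong (uncurry (λ j x → uncurry (λ m w → leaf m w x) (remQuot {M} W j))) (FinP.remQuot-combine (combine m w) x))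
    (cong (uncurry (λ m w → leaf m w x)) (FinP.remQuot-combine m w))

  add₂-value : ∀ m → add₂Val m ≋ block m
  add₂-value m = PR.trans (sumP-tabulate mul₁Val (combine m)) (∑ᶠ-cong λ w →
    PR.trans (prodP-tabulate leafVal (combine (combine m w))) (∏ᶠ-cong λ x →
      PR.trans (leafVal-inp Γ _) (PR.reflexive (cong leafPoly (inp-combine m w x)))))

  value : outVal ≋ ∑ᶠ (λ t → ∏ᶠ (λ j → block (sel t j)))
  value = PR.trans (sumP-tabulate mul₃Val id) (∑ᶠ-cong λ t →
    PR.trans (prodP-tabulate add₂Val (sel t)) (∏ᶠ-cong λ j → add₂-value (sel t j)))

  simpleAdd : SimpleAdd
  simpleAdd = (λ m → Uniq.tabulate⁺ (λ {i} {j} e → FinP.combine-injectiveʳ m i m j e)) , Uniq.allFin⁺ T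

  fanIn : ∀ {d} → FanInOK d R → MulFanInOK d Γ
  fanIn {d} ok = (λ j → bound (combine j)) , (λ t → bound (sel t))
    where
    bound : ∀ {A : Set} (h : Fin R → A) → FanInOK d (length (tabulate h))
    bound h rewrite ListP.length-tabulate h = ok

  constBits : ∀ {b} → (∀ m w x z → leaf m w x ≡ num z → ∣ z ∣ < 2 ^ b) → ConstBits≤ b
  constBits h i z = h _ _ _ z

-- Each of the T * R uses of an addition gate gets its own copy of the gate and of everything below
-- it. Copy `combine t j` imitates `sel t j`, and `combine` uses each copy once.
formula : ∀ {k} T M W R → (Fin T → Fin R → Fin M) → (Fin M → Fin W → Fin R → Leaf k) → Depth4 k
formula T M W R sel leaf = Build.Γ T (T * R) W R combine (λ g → leaf (uncurry sel (remQuot R g)))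

isFormula : ∀ {k} T M W R sel (leaf : Fin M → Fin W → Fin R → Leaf k) → Depth4.IsFormula (formula T M W R sel leaf)
isFormula T M W R sel leaf = concatMap-combine (T * R * W) R , concatMap-combine (T * R) W , concatMap-combine T R , ↭-refl

formula-value : ∀ {k} T M W R sel (leaf : Fin M → Fin W → Fin R → Leaf k) →
  Depth4.outVal (formula T M W R sel leaf) ≋ Depth4.outVal (Build.Γ T M W R sel leaf)
formula-value T M W R sel leaf = PR.trans (Build.value T (T * R) W R combine (λ g → leaf (uncurry sel (remQuot R g))))
  (PR.trans (∑ᶠ-cong λ t → ∏ᶠ-cong λ j → PR.reflexive (cong (λ p → Build.block T M W R sel leaf (uncurry sel p)) (FinP.remQuot-combine t j)))
    (PR.sym (Build.value T M W R sel leaf)))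

module _ {A : Set} where

  words-length : ∀ L n → All (λ w → length w ≤ n) (words {A} L n)
  words-length L zero = z≤n ∷ []
  words-length L (suc n) = z≤n ∷ AllP.cartesianProductWith⁺ (≡.setoid A) (≡.setoid (List A)) _∷_ L (words L n)
    (λ _ w∈ → s≤s (All.lookup (words-length L n) w∈))

length-concatMap-≤ : ∀ {A B : Set} (f : A → List B) c {xs} → All (λ x → length (f x) ≤ c) xs →
  length (concatMap f xs) ≤ length xs * c
length-concatMap-≤ f c [] = z≤n
length-concatMap-≤ f c (_∷_ {x} {xs} p ps) = ℕP.≤-trans (ℕP.≤-reflexive (ListP.length-++ (f x)))
  (ℕP.+-mono-≤ p (length-concatMap-≤ f c ps))

-- The circuit and the formula of a given output gate

module Assemble {k s} (C : Circuit k s) (D d r : ℕ)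
  (o : Fin s) (o≤D : degAt C o ≤ D) (vanish : VanishesAbove d (valAt C o)) (d≤ : d ≤ suc r * r) where

  open Machine C D d
  open Run C D d r
  open Blocks o o≤D vanish

  states : List State
  states = nothing ∷ map just 𝒮

  𝓛 : List Label
  𝓛 = cartesianProduct states 𝒮

  _≟ˡ_ : DecidableEquality Label
  _≟ˡ_ = ×P.≡-dec (MaybeP.≡-dec (ListP.≡-dec (×P.≡-dec Fin._≟_ ℕP._≟_))) (ListP.≡-dec (×P.≡-dec Fin._≟_ ℕP._≟_))

  open import Data.List.Membership.DecPropositional _≟ˡ_ using (_∈?_)

  private
    someLabel : (nothing , []) ∈ 𝓛
    someLabel = ∈P.∈-cartesianProduct⁺ {xs = states} {ys = 𝒮} (here refl) (𝒮-∈ [] (tt , z≤n))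

  -- The default only makes the function total; by `paths-labels` every label on a path from
  -- `nothing` lies in `𝓛`.
  encode : Label → Fin (length 𝓛)
  encode l with l ∈? 𝓛
  ... | yes l∈ = index l∈
  ... | no _ = index someLabel

  decode-encode : ∀ {l} → l ∈ 𝓛 → List.lookup 𝓛 (encode l) ≡ l
  decode-encode {l} l∈ with l ∈? 𝓛
  ... | yes p = sym (lookup-index p)
  ... | no np = ⊥-elim (np l∈)

  paths-labels : ∀ j {a} → a ∈ states → All (VAll.All (_∈ 𝓛)) (paths j a)
  paths-labels zero a∈ = [] ∷ []
  paths-labels (suc j) a∈ = AllP.concat⁺ (AllP.map⁺ (All.tabulate (λ {S} S∈ →
    let S∈𝒮 = proj₁ (∈P.∈-filter⁻ (within? j) {xs = 𝒮} S∈) in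
    AllP.map⁺ (All.map (λ p → ∈P.∈-cartesianProduct⁺ a∈ S∈𝒮 ∷ p) (paths-labels j (there (∈P.∈-map⁺ just S∈𝒮)))))))

  length-paths : ∀ j a → length (paths j a) ≤ length 𝒮 ^ j
  length-paths zero a = s≤s z≤n
  length-paths (suc j) a = ℕP.≤-trans
    (length-concatMap-≤ (λ S → map ((a , S) ∷_) (paths j (just S))) (length 𝒮 ^ j)
      (All.universal (λ S → ℕP.≤-trans (ℕP.≤-reflexive (ListP.length-map ((a , S) ∷_) (paths j (just S)))) (length-paths j (just S))) (targets j)))
    (ℕP.*-monoˡ-≤ (length 𝒮 ^ j) (ListP.length-filter (within? j) 𝒮))

  -- Filling up with the constant 1 gives all bottom gates the same fan-in, so the layers can be
  -- indexed through `combine`.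
  pad : Word → ∀ {n} → Fin n → Leaf k
  pad [] _ = num 1ℤ
  pad (x ∷ w) zero = gateLeaf (gateAt C x)
  pad (x ∷ w) (suc i) = pad w i

  pad-value : ∀ w n → length w ≤ n → ∏ᶠ {n = n} (λ i → leafPoly (pad w i)) ≋ word w
  pad-value [] zero le = ≋-refl
  pad-value [] (suc n) le = PR.trans (PR.*-identityˡ _) (pad-value [] n z≤n)
  pad-value (x ∷ w) (suc n) (s≤s le) = PR.*-congˡ (pad-value w n le)

  monomial : Label → Word → Fin (suc r) → Leaf k
  monomial l w zero = num (coefficient l w)
  monomial l w (suc i) = pad w i

  P : List (Vec Label (suc r))
  P = paths (suc r) nothing

  sel : Fin (length P) → Fin (suc r) → Fin (length 𝓛)
  sel t j = encode (Vec.lookup (List.lookup P t) j)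

  leaf : Fin (length 𝓛) → Fin (length 𝒲) → Fin (suc r) → Leaf k
  leaf m w = monomial (List.lookup 𝓛 m) (List.lookup 𝒲 w)

  module B = Build (length P) (length 𝓛) (length 𝒲) (suc r) sel leaf

  Γ F : Depth4 k
  Γ = B.Γ
  F = formula (length P) (length 𝓛) (length 𝒲) (suc r) sel leaf

  block-value : ∀ m → B.block m ≋ blockVal (List.lookup 𝓛 m)
  block-value m = PR.trans (∑ᶠ-lookup 𝒲 (λ w → ∏ᶠ (λ x → leafPoly (monomial (List.lookup 𝓛 m) w x))))
    (PΣ.∑-congᴬ (All.map (λ {w} le → PR.*-congˡ (pad-value w r le)) (words-length (allFin s) r)))

  path-value : ∀ {j} {p : Vec Label j} → VAll.All (_∈ 𝓛) p → ∏ᶠ (λ i → B.block (encode (Vec.lookup p i))) ≋ pathVal p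
  path-value [] = ≋-refl
  path-value {p = l ∷ _} (l∈ ∷ ls) = PR.*-cong
    (PR.trans (block-value (encode l)) (PR.reflexive (cong blockVal (decode-encode l∈)))) (path-value ls)

  Γ-value : Depth4.outVal Γ ≋ valAt C o
  Γ-value = PR.trans B.value (PR.trans
    (∑ᶠ-lookup P (λ p → ∏ᶠ (λ i → B.block (encode (Vec.lookup p i)))))
    (PR.trans (PΣ.∑-congᴬ (All.map path-value (paths-labels (suc r) (here refl)))) (start-paths-sound r d≤)))

  F-value : Depth4.outVal F ≋ valAt C o
  F-value = PR.trans (formula-value (length P) (length 𝓛) (length 𝒲) (suc r) sel leaf) Γ-value

  N̂ : ℕ
  N̂ = 2 ^ (suc d * (s * D))

  N≤N̂ : ∀ i → degAt C i ≤ D → N i ≤ N̂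
  N≤N̂ i le = ℕP.^-monoʳ-≤ 2 (ℕP.*-monoʳ-≤ (suc d) (ℕP.*-mono-≤ (ℕP.m∸n≤m s (toℕ i)) le))

  Φ≤N̂ : ∀ p S → OK p S → Φ S ≤ N̂ ^ length S
  Φ≤N̂ p [] _ = s≤s z≤n
  Φ≤N̂ p ((i , e) ∷ S) (_ , _ , le , ok) = ℕP.*-mono-≤ (N≤N̂ i le) (Φ≤N̂ (p + e) S ok)

  private instance
    N̂≢0 : NonZero N̂
    N̂≢0 = ℕP.m^n≢0 2 (suc d * (s * D))

  -- A legal stack has at most `lg d` entries, so its potential is at most `N̂ ^ lg d`. The factor
  -- `suc d` accounts for the d + 1 degrees in which `start` begins.
  coefBound : ℕ
  coefBound = suc d * N̂ ^ lg d

  coefBound-pos : 1 ≤ coefBound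
  coefBound-pos = ℕP.*-mono-≤ (s≤s (z≤n {d})) (ℕP.m^n>0 N̂ (lg d))

  entries-weights : ∀ {a} → a ∈ states → weights (entries a) ≤ coefBound
  entries-weights (here refl) = ℕP.≤-trans start-weights (ℕP.*-monoʳ-≤ (suc d) (ℕP.≤-trans (N≤N̂ o o≤D)
    (ℕP.≤-trans (ℕP.≤-reflexive (sym (ℕP.*-identityʳ N̂))) (ℕP.^-monoʳ-≤ N̂ {1} {lg d} (s≤s z≤n)))))
  entries-weights (there a∈) with ∈P.∈-map⁻ just a∈
  ... | S , S∈ , refl = let legal = proj₂ (∈P.∈-filter⁻ legal? {xs = words items (lg d)} S∈) in
    ℕP.≤-trans (run-weights r S (proj₁ legal) (proj₂ legal))
      (ℕP.≤-trans (Φ≤N̂ 0 S (proj₁ legal)) (ℕP.≤-trans (ℕP.^-monoʳ-≤ N̂ (length-legal S legal)) (ℕP.m≤n*m (N̂ ^ lg d) (suc d))))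

  ∣coefficient∣≤ : ∀ {l} w → l ∈ 𝓛 → ∣ coefficient l w ∣ ≤ coefBound
  ∣coefficient∣≤ {a , S} w l∈ = ℕP.≤-trans (Collect.∣coef∣≤ _≟ʷ_ (entries a) (w , S))
    (ℕP.≤-trans (abs≤weights (entries a)) (entries-weights (proj₁ (∈P.∈-cartesianProduct⁻ states 𝒮 l∈))))
    where
    abs≤weights : ∀ (E : List (Entry Word)) → sum (map (λ t → ∣ proj₁ t ∣) E) ≤ weights E
    abs≤weights [] = z≤n
    abs≤weights (t ∷ E) = ℕP.+-mono-≤ (ℕP.≤-trans (ℕP.≤-reflexive (sym (ℕP.*-identityʳ ∣ proj₁ t ∣)))
      (ℕP.*-monoʳ-≤ ∣ proj₁ t ∣ (Φ-pos (stack t)))) (abs≤weights E)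

  leaf-bound : ∀ m w x z → leaf m w x ≡ num z → ∣ z ∣ ≤ coefBound
  leaf-bound m w zero z refl = ∣coefficient∣≤ {List.lookup 𝓛 m} (List.lookup 𝒲 w) (∈P.∈-lookup {xs = 𝓛} m)
  leaf-bound m w (suc x) z eq = padded (List.lookup 𝒲 w) x eq
    where
    gate-bound : ∀ (g : Gate k s) {z} → gateLeaf g ≡ num z → ∣ z ∣ ≤ coefBound
    gate-bound (input-cst c) refl = z≤n
    gate-bound (add a b) refl = z≤n
    gate-bound (mul a b) refl = z≤n
    padded : ∀ w {n} (x : Fin n) {z} → pad w x ≡ num z → ∣ z ∣ ≤ coefBound
    padded [] x refl = coefBound-pos
    padded (i ∷ w) zero eq = gate-bound (gateAt C i) eq
    padded (i ∷ w) (suc x) eq = padded w x eq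

  length-𝒮 : length 𝒮 ≤ suc (s * suc d) ^ lg d
  length-𝒮 = ℕP.≤-trans (ListP.length-filter legal? (words items (lg d))) (ℕP.≤-trans (length-words items (lg d))
    (ℕP.≤-reflexive (cong (λ t → suc t ^ lg d) (trans (length-cartesianProductWith _,_ (allFin s) (List.upTo (suc d)))
      (cong₂ _*_ (ListP.length-tabulate {n = s} id) (ListP.length-upTo (suc d)))))))

  length-𝓛 : length 𝓛 ≡ suc (length 𝒮) * length 𝒮
  length-𝓛 = trans (length-cartesianProductWith _,_ states 𝒮) (cong (λ t → suc t * length 𝒮) (ListP.length-map just 𝒮))

  length-𝒲 : length 𝒲 ≤ suc s ^ r
  length-𝒲 = subst (λ t → length 𝒲 ≤ suc t ^ r) (ListP.length-tabulate {n = s} id) (length-words (allFin s) r)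

  module FB = Build {k} (length P) (length P * suc r) (length 𝒲) (suc r) combine
    (λ g → leaf (uncurry sel (remQuot (suc r) g)))

  F-isFormula : Depth4.IsFormula F
  F-isFormula = isFormula (length P) (length 𝓛) (length 𝒲) (suc r) sel leaf

  Γ-constBits : ∀ {b} → coefBound < 2 ^ b → Depth4.ConstBits≤ Γ b
  Γ-constBits {b} lt = B.constBits {b} (λ m w x z eq → ℕP.≤-<-trans (leaf-bound m w x z eq) lt)

  F-constBits : ∀ {b} → coefBound < 2 ^ b → Depth4.ConstBits≤ F b
  F-constBits {b} lt = FB.constBits {b} (λ g w x z eq →
    ℕP.≤-<-trans (leaf-bound (uncurry sel (remQuot (suc r) g)) w x z eq) lt)

-- Square roots and size estimates

-- The search loop of ⌊√_⌋ is a local function of Defs; the metavariable is solved to it by √-unfold.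
mutual
  search : ℕ → ℕ → ℕ
  search = _

  √-unfold : ∀ d → suc d < suc d * suc d → ⌊√ suc d ⌋ ≡ search (suc d) d
  √-unfold d lt with suc d * suc d ≤? suc d
  ... | yes le = ⊥-elim (ℕP.<⇒≱ lt le)
  ... | no _ with suc d
  ...   | _ = refl

search-suc : ∀ x r → (suc r * suc r ≤ x × search x (suc r) ≡ suc r) ⊎ (x < suc r * suc r × search x (suc r) ≡ search x r)
search-suc x r with suc r * suc r ≤? x
... | yes p = inj₁ (p , refl)
... | no p = inj₂ (ℕP.≰⇒> p , refl)

search-lower : ∀ x r → search x r * search x r ≤ x
search-lower x zero = z≤n
search-lower x (suc r) with search-suc x r
... | inj₁ (p , eq) rewrite eq = p
... | inj₂ (_ , eq) rewrite eq = search-lower x r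

search-upper : ∀ x r → x < suc r * suc r → x < suc (search x r) * suc (search x r)
search-upper x zero p = p
search-upper x (suc r) p with search-suc x r
... | inj₁ (_ , eq) rewrite eq = p
... | inj₂ (q , eq) rewrite eq = search-upper x r q

√-lower : ∀ d → ⌊√ d ⌋ * ⌊√ d ⌋ ≤ d
√-lower d = search-lower d d

√-upper : ∀ d → d < sq d * sq d
√-upper d = search-upper d d (ℕP.m≤m*n (suc d) (suc d))

-- With r the root of 3d rounded down, 3d ≤ r² + 2r ≤ 3 (r + 1) r.
√3d-blocks : ∀ d → d ≤ suc ⌊√ 3 * d ⌋ * ⌊√ 3 * d ⌋
√3d-blocks d = ℕP.*-cancelˡ-≤ 3 (ℕP.≤-trans (s≤s⁻¹ (√-upper (3 * d))) (bound ⌊√ 3 * d ⌋))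
  where
  bound : ∀ r → r + r * suc r ≤ 3 * (suc r * r)
  bound r = ℕP.≤-trans (ℕP.m≤m+n _ (r + 2 * (r * r))) (ℕP.≤-reflexive (expanded r))
    where
    expanded : ∀ r → r + r * suc r + (r + 2 * (r * r)) ≡ 3 * (suc r * r)
    expanded = solve-∀

-- Otherwise, with σ = `sq d`, 4σ² ≤ 3d ≤ 4d < 4σ².
√3d<2√d : ∀ d → suc ⌊√ 3 * d ⌋ ≤ 2 * sq d
√3d<2√d d = ℕP.≰⇒> λ le → ℕP.<⇒≱ contra (ℕP.≤-trans (ℕP.*-mono-≤ le le) (√-lower (3 * d)))
  where
  four : ∀ σ → 4 * (σ * σ) ≡ 2 * σ * (2 * σ)
  four = solve-∀
  contra : 3 * d < 2 * sq d * (2 * sq d)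
  contra = ℕP.≤-<-trans (ℕP.*-monoˡ-≤ d (ℕP.n≤1+n 3))
    (ℕP.<-≤-trans (ℕP.*-monoʳ-< 4 (√-upper d)) (ℕP.≤-reflexive (four (sq d))))

lg≤suc : ∀ d → lg d ≤ suc d
lg≤suc d = s≤s (ℕP.≤-trans (⌊log₂⌋-mono-≤ (ℕP.<⇒≤ (n<2^n d))) (ℕP.≤-reflexive (⌊log₂[2^n]⌋≡n d)))

suc-polyBound≤ : ∀ c n m .{{_ : NonZero m}} → n ≤ m → suc (polyBound c n) ≤ suc (2 * c) * m ^ c
suc-polyBound≤ c n m n≤m = ℕP.≤-trans
  (ℕP.+-mono-≤ (ℕP.m^n>0 m c) (ℕP.+-mono-≤ (ℕP.*-monoʳ-≤ c (ℕP.^-monoˡ-≤ c n≤m))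
    (ℕP.≤-trans (ℕP.≤-reflexive (sym (ℕP.*-identityʳ c))) (ℕP.*-monoʳ-≤ c (ℕP.m^n>0 m c)))))
  (ℕP.≤-reflexive (collected c (m ^ c)))
  where
  collected : ∀ c x → x + (c * x + c * x) ≡ suc (2 * c) * x
  collected = solve-∀

^-distribʳ-* : ∀ e x y → (x * y) ^ e ≡ x ^ e * y ^ e
^-distribʳ-* zero x y = refl
^-distribʳ-* (suc e) x y = trans (cong (x * y *_) (^-distribʳ-* e x y)) (interchange x y (x ^ e) (y ^ e))
  where open import Algebra.Properties.CommutativeSemigroup ℕP.*-commutativeSemigroup using (interchange)

-- The first summand is the coefficient and the second the exponent required in `general`;
-- `polyBound` has a single parameter, so their sum serves as both.
bitsExponent : ℕ → ℕ
bitsExponent c = 2 * suc (2 * c) ^ 4 + c * 4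

polyBound-bits : ∀ c n → 2 * suc (polyBound c n) ^ 4 ≤ polyBound (bitsExponent c) n
polyBound-bits c n = by n refl
  where
  q = bitsExponent c
  general : ∀ m .{{_ : NonZero m}} → n ≤ m → 2 * suc (polyBound c n) ^ 4 ≤ q * m ^ (c * 4)
  general m n≤m = ℕP.≤-trans (ℕP.*-monoʳ-≤ 2 (ℕP.^-monoˡ-≤ 4 (suc-polyBound≤ c n m n≤m)))
    (ℕP.≤-trans (ℕP.≤-reflexive (trans
      (cong (2 *_) (trans (^-distribʳ-* 4 (suc (2 * c)) (m ^ c)) (cong (suc (2 * c) ^ 4 *_) (ℕP.^-*-assoc m c 4))))
      (sym (ℕP.*-assoc 2 (suc (2 * c) ^ 4) (m ^ (c * 4))))))
    (ℕP.*-monoˡ-≤ (m ^ (c * 4)) (ℕP.m≤m+n (2 * suc (2 * c) ^ 4) (c * 4))))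
  by : ∀ n′ → n ≡ n′ → 2 * suc (polyBound c n) ^ 4 ≤ polyBound q n
  -- At n = 0 the power vanishes and the additive constant of `polyBound` must suffice; it does, by
  -- the estimate at m = 1.
  by zero refl = ℕP.≤-trans (general 1 z≤n) (ℕP.≤-trans
    (ℕP.≤-reflexive (trans (cong (q *_) (ℕP.^-zeroˡ (c * 4))) (ℕP.*-identityʳ q))) (ℕP.m≤n+m q (q * 0 ^ q)))
  by (suc n′) refl = ℕP.≤-trans (general n ℕP.≤-refl) (ℕP.≤-trans
    (ℕP.*-monoʳ-≤ q (ℕP.^-monoʳ-≤ n (ℕP.m≤n+m (c * 4) (2 * suc (2 * c) ^ 4)))) (ℕP.m≤m+n (q * n ^ q) q))

-- The bracket is the exponent from `suc-polyBound≤^`. It is doubled because possible stack entries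
-- are pairs of a gate and a degree.
sizeExponent : ℕ → ℕ
sizeExponent c = 2 * (suc (2 * c) + c)

suc-polyBound≤^ : ∀ c n → 2 ≤ n → suc (polyBound c n) ≤ n ^ (suc (2 * c) + c)
suc-polyBound≤^ c n@(suc _) 2≤n = ℕP.≤-trans (suc-polyBound≤ c n n ℕP.≤-refl) (ℕP.≤-trans
  (ℕP.*-monoˡ-≤ (n ^ c) (ℕP.≤-trans (ℕP.<⇒≤ (n<2^n (suc (2 * c)))) (ℕP.^-monoˡ-≤ (suc (2 * c)) 2≤n)))
  (ℕP.≤-reflexive (sym (ℕP.^-distribˡ-+-* n (suc (2 * c)) c))))

-- Counts are tracked as powers of one base: a product adds exponents, and a sum costs one more
-- because the base is at least 2.
module Powers (Z : ℕ) (2≤Z : 2 ≤ Z) where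

  instance
    Z≢0 : NonZero Z
    Z≢0 = >-nonZero (ℕP.<-trans (s≤s z≤n) 2≤Z)

  weaken : ∀ {x a b} → a ≤ b → x ≤ Z ^ a → x ≤ Z ^ b
  weaken a≤b p = ℕP.≤-trans p (ℕP.^-monoʳ-≤ Z a≤b)

  times : ∀ {x y} a b → x ≤ Z ^ a → y ≤ Z ^ b → x * y ≤ Z ^ (a + b)
  times a b p q = ℕP.≤-trans (ℕP.*-mono-≤ p q) (ℕP.≤-reflexive (sym (ℕP.^-distribˡ-+-* Z a b)))

  plus : ∀ {x y} a → x ≤ Z ^ a → y ≤ Z ^ a → x + y ≤ Z ^ suc a
  plus a p q = ℕP.≤-trans (ℕP.+-mono-≤ p q) (ℕP.≤-trans
    (ℕP.≤-reflexive (cong (Z ^ a +_) (sym (ℕP.+-identityʳ (Z ^ a))))) (ℕP.*-monoˡ-≤ (Z ^ a) 2≤Z))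

  one : ∀ a → 1 ≤ Z ^ a
  one a = ℕP.m^n>0 Z a

pow≤ : ∀ {x m} n β e .{{_ : NonZero n}} → x ≤ n ^ β → m ≤ e → x ^ m ≤ (n ^ e) ^ β
pow≤ {x} {m} n β e p q = ℕP.≤-trans (ℕP.^-monoˡ-≤ m p) (ℕP.≤-trans
  (ℕP.≤-reflexive (ℕP.^-*-assoc n β m)) (ℕP.≤-trans (ℕP.^-monoʳ-≤ n (ℕP.*-monoʳ-≤ β q))
  (ℕP.≤-reflexive (trans (cong (n ^_) (ℕP.*-comm β e)) (sym (ℕP.^-*-assoc n e β))))))

degree≤ : ∀ {k d D} {f : Poly k} → IsDegree f d → VanishesAbove D f → d ≤ D
degree≤ (_ , inj₁ refl) _ = z≤n
degree≤ {d = d} {D} (_ , inj₂ (m , ∣m∣≡d , fm≢0)) v with d ≤? D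
... | yes le = le
... | no nle = ⊥-elim (fm≢0 (v m (subst (D <_) (sym ∣m∣≡d) (ℕP.≰⇒> nle))))

lookup-zero : ∀ {A : Set} {n} (xs : Vec A (suc n)) → Vec.lookup xs zero ≡ Vec.head xs
lookup-zero (x ∷ xs) = refl

-- Bounds for a single member of the family

module Bounds (c n d : ℕ) {k s : ℕ} (f : Poly k) (isDeg : IsDegree f d) (C : Circuit k (suc s))
  (size≤ : suc s ≤ polyBound c n) (deg≤ : formalDegree C ≤ polyBound c n) (computes : output C ≈P f) where

  D r : ℕ
  D = formalDegree C
  r = ⌊√ 3 * d ⌋

  valAt-zero : ∀ m → valAt C zero m ≡ f m
  valAt-zero m = trans (cong (λ g → g m) (lookup-zero (values C))) (computes m)

  d≤D : d ≤ D
  d≤D = degree≤ isDeg (λ m lt → trans (sym (valAt-zero m))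
    (valAt-vanishes C zero m (subst (_< ∣ m ∣ₘ) (sym (lookup-zero (fdegs C))) lt)))

  module A = Assemble C D d r zero (ℕP.≤-reflexive (lookup-zero (fdegs C)))
    (λ m lt → trans (valAt-zero m) (proj₁ isDeg m lt)) (√3d-blocks d)

  Γ-correct : Depth4.outVal A.Γ ≈P f
  Γ-correct m = trans (at A.Γ-value m) (valAt-zero m)

  F-correct : Depth4.outVal A.F ≈P f
  F-correct m = trans (at A.F-value m) (valAt-zero m)

  p : ℕ
  p = polyBound c n

  d<Y : suc d ≤ suc p
  d<Y = s≤s (ℕP.≤-trans d≤D deg≤)

  bits : A.coefBound < 2 ^ polyBound (bitsExponent c) n
  bits = ℕP.<-≤-trans strict (ℕP.^-monoʳ-≤ 2 (ℕP.≤-trans exponent (polyBound-bits c n)))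
    where
    e = suc d * (suc s * D)
    strict : A.coefBound < 2 ^ (suc d + e * lg d)
    strict = ℕP.<-≤-trans (ℕP.*-monoˡ-< (A.N̂ ^ lg d) {{ℕP.m^n≢0 A.N̂ (lg d) {{ℕP.m^n≢0 2 e}}}} (n<2^n (suc d)))
      (ℕP.≤-reflexive (trans (cong (2 ^ suc d *_) (ℕP.^-*-assoc 2 e (lg d))) (sym (ℕP.^-distribˡ-+-* 2 (suc d) (e * lg d)))))
    Y = suc p
    fourth : ∀ y → y * (y * y) * y ≡ y * (y * (y * (y * 1)))
    fourth = solve-∀
    -- `suc d`, `suc s`, `D` and `lg d` are each at most Y, which is where the fourth power in
    -- `bitsExponent` comes from.
    exponent : suc d + e * lg d ≤ 2 * Y ^ 4
    exponent = ℕP.≤-trans (ℕP.+-mono-≤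
      (ℕP.≤-trans d<Y (ℕP.≤-trans (ℕP.≤-reflexive (sym (ℕP.*-identityʳ Y))) (ℕP.^-monoʳ-≤ Y {1} {4} (s≤s z≤n))))
      (ℕP.≤-trans (ℕP.*-mono-≤ (ℕP.*-mono-≤ d<Y (ℕP.*-mono-≤ (ℕP.≤-trans size≤ (ℕP.n≤1+n p)) (ℕP.≤-trans deg≤ (ℕP.n≤1+n p))))
          (ℕP.≤-trans (lg≤suc d) d<Y))
        (ℕP.≤-trans (ℕP.≤-reflexive (fourth Y)) (ℕP.m≤m+n (Y ^ 4) 0))))
      ℕP.≤-refl

  fanIn : FanInOK d (suc r)
  fanIn = √-lower (3 * d)

  module Counts (2≤n : 2 ≤ n) where

    open A using (𝓛; P)
    open Run.Blocks C D d r zero (ℕP.≤-reflexive (lookup-zero (fdegs C))) (λ m lt → trans (valAt-zero m) (proj₁ isDeg m lt)) using (𝒮; 𝒲)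

    β λg σ Y Z : ℕ
    β = sizeExponent c
    λg = lg d
    σ = sq d
    Y = n ^ λg
    Z = n ^ (σ * λg)

    instance
      n≢0 : NonZero n
      n≢0 = >-nonZero (ℕP.<-trans (s≤s z≤n) 2≤n)

    2≤n^ : ∀ e → 1 ≤ e → 2 ≤ n ^ e
    2≤n^ e 1≤e = ℕP.≤-trans 2≤n (ℕP.≤-trans (ℕP.≤-reflexive (sym (ℕP.*-identityʳ n))) (ℕP.^-monoʳ-≤ n {1} 1≤e))

    module YP = Powers Y (2≤n^ λg (s≤s z≤n))
    module ZP = Powers Z (2≤n^ (σ * λg) (s≤s z≤n))

    Y≤Z : Y ≤ Z
    Y≤Z = ℕP.^-monoʳ-≤ n (ℕP.m≤n*m λg σ)

    p²≤ : suc p * suc p ≤ n ^ β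
    p²≤ = ℕP.≤-trans (ℕP.*-mono-≤ h h) (ℕP.≤-reflexive (trans (sym (ℕP.^-distribˡ-+-* n b b)) (cong (λ t → n ^ (b + t)) (sym (ℕP.+-identityʳ b)))))
      where
      b = suc (2 * c) + c
      h = suc-polyBound≤^ c n 2≤n

    items≤ : suc (suc s * suc d) ≤ n ^ β
    items≤ = ℕP.≤-trans (ℕP.+-mono-≤ (s≤s (z≤n {p})) (ℕP.*-mono-≤ size≤ d<Y)) p²≤

    letters≤ : suc (suc s) ≤ n ^ β
    letters≤ = ℕP.≤-trans (s≤s size≤) (ℕP.≤-trans (ℕP.m≤m*n (suc p) (suc p)) p²≤)

    𝒮≤ : length 𝒮 ≤ Y ^ β
    𝒮≤ = ℕP.≤-trans A.length-𝒮 (pow≤ n β λg items≤ ℕP.≤-refl)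

    𝓛≤ : length 𝓛 ≤ Y ^ (suc β + β)
    𝓛≤ = ℕP.≤-trans (ℕP.≤-reflexive A.length-𝓛) (YP.times (suc β) β (YP.plus β (YP.one β) 𝒮≤) 𝒮≤)

    suc-r≤ : suc r ≤ 2 * σ
    suc-r≤ = √3d<2√d d

    2σ≤ : 2 * σ ≤ σ * λg * 2
    2σ≤ = ℕP.≤-trans (ℕP.*-monoʳ-≤ 2 (ℕP.m≤m*n σ λg)) (ℕP.≤-reflexive (ℕP.*-comm 2 (σ * λg)))

    𝒲≤ : length 𝒲 ≤ Z ^ (2 * β)
    𝒲≤ = ℕP.≤-trans A.length-𝒲 (ℕP.≤-trans (pow≤ n β (σ * λg * 2) letters≤ (ℕP.≤-trans (ℕP.≤-trans (ℕP.n≤1+n r) suc-r≤) 2σ≤)) (ℕP.≤-reflexive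
      (trans (cong (_^ β) (sym (ℕP.^-*-assoc n (σ * λg) 2))) (ℕP.^-*-assoc Z 2 β))))

    P≤ : length P ≤ Z ^ (2 * β)
    P≤ = ℕP.≤-trans (A.length-paths (suc r) _) (ℕP.≤-trans (pow≤ Y β (2 * σ) 𝒮≤ suc-r≤) (ℕP.≤-reflexive
      (trans (cong (_^ β) (trans (ℕP.^-*-assoc n λg (2 * σ)) (trans (cong (n ^_) (regroup λg σ)) (sym (ℕP.^-*-assoc n (σ * λg) 2)))))
        (ℕP.^-*-assoc Z 2 β))))
      where
      regroup : ∀ x y → x * (2 * y) ≡ y * x * 2
      regroup = solve-∀

    R≤ : suc r ≤ Z ^ 2
    R≤ = ℕP.≤-trans suc-r≤ (ℕP.≤-trans 2σ≤ (ℕP.≤-trans (ℕP.<⇒≤ (n<2^n (σ * λg * 2)))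
      (ℕP.≤-trans (ℕP.^-monoˡ-≤ (σ * λg * 2) 2≤n) (ℕP.≤-reflexive (sym (ℕP.^-*-assoc n (σ * λg) 2))))))

    -- Dictated by the size of the formula: 2 * β for the paths, 2 * β for the words, 2 for each of
    -- the two fan-ins, and 1 for each of the four additions in `size`.
    γ : ℕ
    γ = 4 * β + 8

    Y^γ : Y ^ γ ≡ n ^ (γ * λg)
    Y^γ = trans (ℕP.^-*-assoc n λg γ) (cong (n ^_) (ℕP.*-comm λg γ))

    Z^γ : Z ^ γ ≡ n ^ (γ * σ * λg)
    Z^γ = trans (ℕP.^-*-assoc n (σ * λg) γ) (cong (n ^_) (trans (ℕP.*-comm (σ * λg) γ) (sym (ℕP.*-assoc γ σ λg))))

    private
      le₁ : suc (suc β + β) ≤ γ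
      le₁ = ℕP.≤-trans (ℕP.m≤m+n _ (2 * β + 6)) (ℕP.≤-reflexive (eq β))
        where
        eq : ∀ b → suc (suc b + b) + (2 * b + 6) ≡ 4 * b + 8
        eq = solve-∀
      le₂ : suc (suc β + β + 2 * β) ≤ γ
      le₂ = ℕP.≤-trans (ℕP.m≤m+n _ 6) (ℕP.≤-reflexive (eq β))
        where
        eq : ∀ b → suc (suc b + b + 2 * b) + 6 ≡ 4 * b + 8
        eq = solve-∀
      le₃ : 2 * β ≤ suc β + β + 2 * β
      le₃ = ℕP.m≤n+m (2 * β) (suc β + β)

    adds≤ : Depth4.#add A.Γ ≤ n ^ (γ * lg d)
    adds≤ = ℕP.≤-trans (YP.weaken le₁ (YP.plus (suc β + β) (YP.one (suc β + β)) 𝓛≤)) (ℕP.≤-reflexive Y^γ)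

    muls≤ : Depth4.#mul A.Γ ≤ n ^ (γ * sq d * lg d)
    muls≤ = ℕP.≤-trans (ZP.weaken le₂ (ZP.plus (suc β + β + 2 * β)
      (ZP.times (suc β + β) (2 * β) (ℕP.≤-trans 𝓛≤ (ℕP.^-monoˡ-≤ (suc β + β) Y≤Z)) 𝒲≤) (ZP.weaken le₃ P≤)))
      (ℕP.≤-reflexive Z^γ)

    formula≤ : Depth4.size A.F ≤ n ^ (γ * sq d * lg d)
    formula≤ = ℕP.≤-trans (ZP.weaken (ℕP.≤-reflexive (total β))
      (ZP.plus (3 + e) (ZP.plus (2 + e) (ZP.plus (1 + e) (ZP.plus e inputs (ZP.weaken (ℕP.m≤m+n e₁ 2) monomials))
        (ZP.weaken (ℕP.≤-trans (ℕP.m≤m+n e₂ (2 * β)) (ℕP.≤-trans (ℕP.m≤m+n e₁ 2) (ℕP.n≤1+n e))) additions))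
        (ZP.weaken (ℕP.≤-trans (ℕP.m≤m+n (2 * β) 2) (ℕP.≤-trans (ℕP.m≤m+n e₂ (2 * β)) (ℕP.≤-trans (ℕP.m≤m+n e₁ 2) (ℕP.m≤n+m e 2)))) P≤))
        (ZP.one (3 + e))))
      (ℕP.≤-reflexive Z^γ)
      where
      e₂ = 2 * β + 2
      e₁ = e₂ + 2 * β
      e = e₁ + 2
      additions : length P * suc r ≤ Z ^ e₂
      additions = ZP.times (2 * β) 2 P≤ R≤
      monomials : length P * suc r * length 𝒲 ≤ Z ^ e₁
      monomials = ZP.times e₂ (2 * β) additions 𝒲≤
      inputs : length P * suc r * length 𝒲 * suc r ≤ Z ^ e
      inputs = ZP.times e₁ 2 monomials R≤
      total : ∀ b → 4 + (2 * b + 2 + 2 * b + 2) ≡ 4 * b + 8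
      total = solve-∀

theorem6 : (v : ℕ → ℕ) (f : (n : ℕ) → Poly (v n)) (d : ℕ → ℕ) →
    VP⁰ v f → (∀ n → IsDegree (f n) (d n)) →
    (Σ ℕ λ c → Σ ℕ λ N → Σ ℕ λ q → ∀ n → Σ (Depth4 (v n)) λ Γ →
    Depth4.outVal Γ ≈P f n ×
    Depth4.SimpleAdd Γ ×
    MulFanInOK (d n) Γ ×
    Depth4.ConstBits≤ Γ (polyBound q n) ×
    (N ≤ n → Depth4.#add Γ ≤ n ^ (c * lg (d n)) ×
    Depth4.#mul Γ ≤ n ^ (c * sq (d n) * lg (d n))))
    ×
    (Σ ℕ λ c → Σ ℕ λ N → Σ ℕ λ q → ∀ n → Σ (Depth4 (v n)) λ F →
    Depth4.IsFormula F ×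
    Depth4.outVal F ≈P f n ×
    MulFanInOK (d n) F ×
    Depth4.ConstBits≤ F (polyBound q n) ×
    (N ≤ n → Depth4.size F ≤ n ^ (c * sq (d n) * lg (d n))))
theorem6 v f d (c , circuits) isDeg =
  -- From n = 2 on, powers of n absorb constant factors. The construction and the bound on the
  -- constants hold for every n.
  (γ , 2 , bitsExponent c , λ n → let open At n in
    A.Γ , Γ-correct , A.B.simpleAdd , A.B.fanIn {d n} fanIn ,
    A.Γ-constBits {polyBound (bitsExponent c) n} bits ,
    λ 2≤n → Counts.adds≤ 2≤n , Counts.muls≤ 2≤n) ,
  (γ , 2 , bitsExponent c , λ n → let open At n in
    A.F , A.F-isFormula , F-correct , A.FB.fanIn {d n} fanIn ,
    A.F-constBits {polyBound (bitsExponent c) n} bits ,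
    λ 2≤n → Counts.formula≤ 2≤n)
  where
  γ = 4 * sizeExponent c + 8
  module At (n : ℕ) where
    open Bounds c n (d n) (f n) (isDeg n) (proj₁ (proj₂ (circuits n))) (proj₁ (proj₂ (proj₂ (circuits n))))
      (proj₁ (proj₂ (proj₂ (proj₂ (circuits n))))) (proj₂ (proj₂ (proj₂ (proj₂ (circuits n))))) public
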